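{- Let $P_{(3,1)}$ be the set of all cylindric partitions with profile $c=(3,1)$. Then, as formal power series in $q$, $$\sum_{\Lambda\in P_{(3,1)}} q^{|\Lambda|}=\left(\sum_{n\ge0}\frac{q^{n^2}}{(q^2;q^2)_n}\right)\frac{(-q^2;q^2)_\infty}{(q;q)_\infty}.$$
   Context: Let $r,\ell$ be positive integers and $c=(c_1,\dots,c_r)$ a composition of $\ell$ into $r$ nonnegative integer parts (zero entries allowed). A cylindric partition with profile $c$ is a tuple $\Lambda=(\lambda^{(1)},\dots,\lambda^{(r)})$ of ordinary partitions $\lambda^{(i)}=(\lambda^{(i)}_1\ge\lambda^{(i)}_2\ge\cdots)$ (parts beyond the length are taken to be $0$) such that for all $i,j$: $\lambda^{(i)}_j\ge\lambda^{(i+1)}_{j+c_{i+1}}$ for $1\le i\le r-1$, and $\lambda^{(r)}_j\ge\lambda^{(1)}_{j+c_1}$. The size $|\Lambda|$ is the sum of all parts of all $\lambda^{(i)}$; the empty cylindric partition is included with size $0$. Notation: $(a;q)_n=\prod_{k=1}^n(1-aq^{k-1})$, $(a;q)_\infty=\lim_{n\to\infty}(a;q)_n$. -}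

module Defs where

open import Data.Nat as ℕ using (ℕ; zero; suc; _≤_; _≥_; _∸_; _+_)
open import Data.Nat.DivMod using (_%_; m%n<n)
open import Data.Nat.Divisibility using (_∣?_)
open import Data.Integer as ℤ using (ℤ; +_)
open import Data.Fin using (Fin; toℕ; fromℕ<)
open import Data.List as List using (List; []; _∷_)
open import Data.List.Relation.Unary.All using (All)
import Data.Nat.ListAction as ListAction
open import Data.List.Relation.Unary.Linked using (Linked)
open import Data.Vec as Vec using (Vec; lookup)
open import Relation.Binary.PropositionalEquality using (_≡_)
open import Relation.Nullary.Decidable using (does)
open import Data.Bool using (if_then_else_)

-- Ordinary partitions: weakly decreasing lists of positive integers.
-- (Proof fields are irrelevant, so a partition is determined by its parts.)

record Partition : Set where
  constructor mkPartition
  field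
    parts : List ℕ
    .decreasing : Linked _≥_ parts
    .positive   : All (λ x → 1 ≤ x) parts
open Partition public

-- j-th part, 0-indexed (at λ 0 = λ_1); parts beyond the length are 0.
at : List ℕ → ℕ → ℕ
at []       _       = 0
at (x ∷ xs) zero    = x
at (x ∷ xs) (suc j) = at xs j

next : ∀ {r} → Fin (suc r) → Fin (suc r)
next {r} i = fromℕ< (m%n<n (suc (toℕ i)) (suc r))

IsCylindric : ∀ {r} → Vec ℕ (suc r) → Vec Partition (suc r) → Set
IsCylindric c Λ = ∀ i j →
  at (parts (lookup Λ (next i))) (j + lookup c (next i)) ≤ at (parts (lookup Λ i)) j

size : ∀ {n} → Vec Partition n → ℕ
size Λ = Vec.sum (Vec.map (λ p → ListAction.sum (parts p)) Λ)

record CylPartOfSize {r : ℕ} (c : Vec ℕ (suc r)) (N : ℕ) : Set where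
  constructor mkCyl
  field
    shape : Vec Partition (suc r)
    .cylindric : IsCylindric c shape
    .hasSize   : size shape ≡ N
open CylPartOfSize public

FPS : Set
FPS = ℕ → ℤ

sumTo : (ℕ → ℤ) → ℕ → ℤ
sumTo f zero    = f 0
sumTo f (suc n) = sumTo f n ℤ.+ f (suc n)

infixl 7 _⊛_
_⊛_ : FPS → FPS → FPS
(f ⊛ g) n = sumTo (λ i → f i ℤ.* g (n ∸ i)) n

oneS : FPS
oneS zero    = + 1
oneS (suc _) = + 0

mono : ℤ → ℕ → FPS
mono a k n = if does (n ℕ.≟ k) then a else + 0

onePlusQ : ℕ → FPS
onePlusQ k n = oneS n ℤ.+ mono (+ 1) k n

-- 1/(1 - q^k) = Σ_{m≥0} q^{km}   (used only for k ≥ 1)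
geomInv : ℕ → FPS
geomInv k n = if does (k ∣? n) then + 1 else + 0

prodTo : (ℕ → FPS) → ℕ → FPS
prodTo F zero    = oneS
prodTo F (suc m) = prodTo F m ⊛ F (suc m)

-- ∏_{k≥1} F k, for factors with F k ≡ 1 mod q^k: the coefficient of q^N
-- is that of the finite product up to k = N.
prodInf : (ℕ → FPS) → FPS
prodInf F N = prodTo F N N

invQ2Poch : ℕ → FPS
invQ2Poch n = prodTo (λ k → geomInv (2 ℕ.* k)) n

-- Σ_{n≥0} q^{n^2}/(q^2;q^2)_n ; terms with n > N do not contribute to q^N
rogersRamanujanSum : FPS
rogersRamanujanSum N = sumTo (λ n → (mono (+ 1) (n ℕ.* n) ⊛ invQ2Poch n) N) N

negQ2PochInf : FPS
negQ2PochInf = prodInf (λ k → onePlusQ (2 ℕ.* k))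

invQPochInf : FPS
invQPochInf = prodInf geomInv

rhs53 : FPS
rhs53 = rogersRamanujanSum ⊛ negQ2PochInf ⊛ invQPochInf

profile31 : Vec ℕ 2
profile31 = 3 Vec.∷ 1 Vec.∷ Vec.[]

{-# OPTIONS --safe #-}
module Submission where

open import Defs
open import Algebra.Bundles using (CommutativeRing)
open import Algebra.Properties.Ring using (-‿distribˡ-*; -‿distribʳ-*)
import Algebra.Solver.Ring as RingSolver
open import Algebra.Solver.Ring.AlmostCommutativeRing
  using (fromCommutativeRing; _-Raw-AlmostCommutative⟶_)
import Algebra.Solver.Ring.NaturalCoefficients.Default as SemiringSolver
open import Data.Bool using (if_then_else_)
open import Data.Empty using (⊥-elim)
open import Data.Fin using (Fin; zero; suc)
open import Data.Integer using (+_)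
import Data.Integer as ℤ
import Data.Integer.Properties as ℤ
open import Data.Irrelevant using (Irrelevant) renaming ([_] to squash)
open import Data.List as List using (List; []; _∷_; length; map; _++_)
open import Data.List.Membership.Propositional using (_∈_)
open import Data.List.Membership.Propositional.Properties
  using (∈-map⁺; ∈-map⁻; ∈-++⁺ˡ; ∈-++⁺ʳ; ∈-++⁻; ∈-lookup)
open import Data.List.Membership.Propositional.Properties.WithK using (unique∧set⇒bag)
import Data.List.Membership.DecPropositional as DecMembership
import Data.List.Properties as List
open import Data.List.Relation.Binary.BagAndSetEquality using (∼bag⇒↭)
open import Data.List.Relation.Binary.Permutation.Propositional.Properties using (↭-length)
open import Data.List.Relation.Unary.All as All using (All; []; _∷_)
open import Data.List.Relation.Unary.AllPairs using ([]; _∷_)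
open import Data.List.Relation.Unary.Any using (here; there; index)
open import Data.List.Relation.Unary.Any.Properties using (lookup-index)
open import Data.List.Relation.Unary.Linked using (Linked; []; [-]; _∷_)
open import Data.List.Relation.Unary.Unique.Propositional using (Unique)
import Data.List.Relation.Unary.Unique.Propositional.Properties as Unique
open import Data.Maybe as Maybe using (Maybe)
open import Data.Nat using (ℕ; zero; suc; pred; _∸_; _≤_; _<_; _≥_; z≤n; s≤s; s≤s⁻¹; _≤?_; _<?_; >-nonZero)
import Data.Nat as ℕ
open import Data.Nat.Divisibility using (_∣?_; ∣-refl; ∣m+n∣m⇒∣n; ∣m∣n⇒∣m+n; _∣0; ∣⇒≤)
open import Data.Nat.Induction using (<-rec)
open import Data.Nat.ListAction using (sum)
import Data.Nat.Properties as ℕ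
open import Data.Nat.Solver using (module +-*-Solver)
open import Data.Product using (∃-syntax; _×_; _,_; proj₁; proj₂)
import Data.Product.Properties as Product
open import Data.Sum using (_⊎_; inj₁; inj₂; [_,_])
open import Data.Vec using ([]; _∷_)
open import Function.Bundles using (_↔_; mk↔ₛ′; mk⇔)
open import Relation.Binary.PropositionalEquality as ≡ using (_≡_)
import Relation.Binary.Reasoning.Setoid as SetoidReasoning
open import Relation.Nullary using (¬_; Dec; yes; no)
open import Relation.Nullary.Decidable using (does-⇔; dec-true; dec-false; dec⇒maybe; recompute)

-- Let B(a, b) be the generating function of the cylindric partitions (λ, μ) with at most a and b parts.
-- If λ and μ have exactly a and b parts, subtracting 1 from each part gives a pair counted by B(a, b) again;
-- otherwise the pair is counted by B(a-1, b) or B(a, b-1). Hence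
--   (1 - q^(a+b)) B(a, b) = B(a-1, b) + B(a, b-1) - B(a-1, b-1)   for -1 ≤ a - b ≤ 3, (a, b) ≠ (0, 0).
-- After multiplication by (q;q)_(a+b) the five diagonals d = a - b are polynomials; eliminating d = -1 and
-- d = 3, the sequences y_k (d = 1) and t_k (the sum of d = 0 and d = 2) satisfy, with p = q²,
--   t_(k+1) = 2 y_k + q^(2k+1) t_k,   t_k = y_k + (1 - p^k) y_(k-1).
-- This system is solved by y_k = Σ_j q^(j²) [k j]_p (-p;p)_(k-j) and t_k = Σ_j q^(j²) [k j]_p (-1;p)_(k-j),
-- and letting k → ∞ in B(k+1, k) = y_k / (q;q)_(2k+1) gives the claim.

-- Formal power series over a commutative ring.

module PowerSeries {c ℓ} (R : CommutativeRing c ℓ) where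
  open CommutativeRing R
  open import Relation.Binary.Reasoning.Setoid setoid
  private module S = SemiringSolver commutativeSemiring

  Series : Set c
  Series = ℕ → Carrier

  infix 4 _≋_
  _≋_ : Series → Series → Set ℓ
  f ≋ g = ∀ n → f n ≈ g n

  tail : Series → Series
  tail f n = f (suc n)

  const : Carrier → Series
  const a zero    = a
  const a (suc _) = 0#

  infixl 7 _⊗_ _·_
  infixl 6 _⊕_
  _⊕_ : Series → Series → Series
  (f ⊕ g) n = f n + g n

  ⊖_ : Series → Series
  (⊖ f) n = - f n

  _·_ : Carrier → Series → Series
  (a · f) n = a * f n

  -- The Cauchy product, by a recursion that splits off the constant term of the left factor, so
  -- that the ring laws follow by induction on the index. The construction is used twice: over ℤ,
  -- and over the resulting ring to obtain a second variable z.
  _⊗_ : Series → Series → Series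
  (f ⊗ g) zero    = f 0 * g 0
  (f ⊗ g) (suc n) = f 0 * g (suc n) + (tail f ⊗ g) n

  -- Coefficient `n` of a product sees no coefficient of either factor beyond `n`; this makes
  -- truncation modulo a power of q compatible with products.
  ⊗-cong-≤ : ∀ {f f′ g g′} n → (∀ {i} → i ℕ.≤ n → f i ≈ f′ i) →
             (∀ {i} → i ℕ.≤ n → g i ≈ g′ i) → (f ⊗ g) n ≈ (f′ ⊗ g′) n
  ⊗-cong-≤ zero    p q = *-cong (p ℕ.z≤n) (q ℕ.z≤n)
  ⊗-cong-≤ (suc n) p q = +-cong (*-cong (p ℕ.z≤n) (q ≤-refl))
    (⊗-cong-≤ n (λ i≤n → p (ℕ.s≤s i≤n)) (λ i≤n → q (m≤n⇒m≤1+n i≤n)))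
    where open import Data.Nat.Properties using (≤-refl; m≤n⇒m≤1+n)

  ⊗-cong : ∀ {f f′ g g′} → f ≋ f′ → g ≋ g′ → f ⊗ g ≋ f′ ⊗ g′
  ⊗-cong p q n = ⊗-cong-≤ n (λ _ → p _) (λ _ → q _)

  zeroS : Series
  zeroS _ = 0#

  ⊗-zeroˡ : ∀ g → zeroS ⊗ g ≋ zeroS
  ⊗-zeroˡ g zero    = zeroˡ (g 0)
  ⊗-zeroˡ g (suc n) = trans (+-cong (zeroˡ _) (⊗-zeroˡ g n)) (+-identityˡ 0#)

  const-⊗ : ∀ a g → const a ⊗ g ≋ a · g
  const-⊗ a g zero    = refl
  const-⊗ a g (suc n) = trans (+-congˡ (⊗-zeroˡ g n)) (+-identityʳ _)

  ⊗-identityˡ : ∀ g → const 1# ⊗ g ≋ g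
  ⊗-identityˡ g n = trans (const-⊗ 1# g n) (*-identityˡ (g n))

  ⊗-distribʳ : ∀ h f g → (f ⊕ g) ⊗ h ≋ f ⊗ h ⊕ g ⊗ h
  ⊗-distribʳ h f g zero    = distribʳ (h 0) (f 0) (g 0)
  ⊗-distribʳ h f g (suc n) = trans (+-congˡ (⊗-distribʳ h (tail f) (tail g) n))
    (S.solve 5 (λ a b x y z → (a S.:+ b) S.:* x S.:+ (y S.:+ z) S.:=
                              (a S.:* x S.:+ y) S.:+ (b S.:* x S.:+ z))
             refl (f 0) (g 0) (h (suc n)) _ _)

  ·-⊗ : ∀ a f g → (a · f) ⊗ g ≋ a · (f ⊗ g)
  ·-⊗ a f g zero    = *-assoc _ _ _
  ·-⊗ a f g (suc n) = begin
    a * f 0 * g (suc n) + ((a · tail f) ⊗ g) n  ≈⟨ +-cong (*-assoc _ _ _) (·-⊗ a (tail f) g n) ⟩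
    a * (f 0 * g (suc n)) + a * (tail f ⊗ g) n  ≈⟨ sym (distribˡ _ _ _) ⟩
    a * (f 0 * g (suc n) + (tail f ⊗ g) n)  ∎

  ⊗-assoc : ∀ f g h → (f ⊗ g) ⊗ h ≋ f ⊗ (g ⊗ h)
  ⊗-assoc f g h zero    = *-assoc _ _ _
  ⊗-assoc f g h (suc n) = begin
    f 0 * g 0 * h (suc n) + (((f 0 · tail g) ⊕ (tail f ⊗ g)) ⊗ h) n
      ≈⟨ +-congˡ (⊗-distribʳ h (f 0 · tail g) (tail f ⊗ g) n) ⟩
    f 0 * g 0 * h (suc n) + (((f 0 · tail g) ⊗ h) n + ((tail f ⊗ g) ⊗ h) n)
      ≈⟨ +-congˡ (+-cong (·-⊗ (f 0) (tail g) h n) (⊗-assoc (tail f) g h n)) ⟩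
    f 0 * g 0 * h (suc n) + (f 0 * (tail g ⊗ h) n + (tail f ⊗ (g ⊗ h)) n)
      ≈⟨ S.solve 5 (λ a b c x y → a S.:* b S.:* c S.:+ (a S.:* x S.:+ y) S.:=
                                  a S.:* (b S.:* c S.:+ x) S.:+ y)
                 refl (f 0) (g 0) (h (suc n)) _ _ ⟩
    f 0 * (g 0 * h (suc n) + (tail g ⊗ h) n) + (tail f ⊗ (g ⊗ h)) n ∎

  -- Splits off the constant term of the right factor instead; commutativity needs this because the
  -- definition is asymmetric.
  ⊗-suc : ∀ f g n → (f ⊗ g) (suc n) ≈ (f ⊗ tail g) n + f (suc n) * g 0
  ⊗-suc f g zero    = refl
  ⊗-suc f g (suc n) = trans (+-congˡ (⊗-suc (tail f) g n)) (sym (+-assoc _ _ _))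

  ⊗-comm : ∀ f g → f ⊗ g ≋ g ⊗ f
  ⊗-comm f g zero    = *-comm _ _
  ⊗-comm f g (suc n) = begin
    f 0 * g (suc n) + (tail f ⊗ g) n ≈⟨ +-cong (*-comm _ _) (⊗-comm (tail f) g n) ⟩
    g (suc n) * f 0 + (g ⊗ tail f) n ≈⟨ +-comm _ _ ⟩
    (g ⊗ tail f) n + g (suc n) * f 0 ≈⟨ sym (⊗-suc g f n) ⟩
    (g ⊗ f) (suc n)  ∎

  ⊗-distribˡ : ∀ h f g → h ⊗ (f ⊕ g) ≋ h ⊗ f ⊕ h ⊗ g
  ⊗-distribˡ h f g n = begin
    (h ⊗ (f ⊕ g)) n  ≈⟨ ⊗-comm h (f ⊕ g) n ⟩
    ((f ⊕ g) ⊗ h) n  ≈⟨ ⊗-distribʳ h f g n ⟩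
    (f ⊗ h) n + (g ⊗ h) n  ≈⟨ +-cong (⊗-comm f h n) (⊗-comm g h n) ⟩
    (h ⊗ f) n + (h ⊗ g) n  ∎

  commutativeRingS : CommutativeRing c ℓ
  commutativeRingS = record
    { Carrier = Series
    ; _≈_ = _≋_
    ; _+_ = _⊕_
    ; _*_ = _⊗_
    ; -_ = ⊖_
    ; 0# = zeroS
    ; 1# = const 1#
    ; isCommutativeRing = record
      { isRing = record
        { +-isAbelianGroup = record
          { isGroup = record
            { isMonoid = record
              { isSemigroup = record
                { isMagma = record
                  { isEquivalence = record
                    { refl = λ _ → refl
                    ; sym = λ p n → sym (p n)
                    ; trans = λ p q n → trans (p n) (q n)
                    }
                  ; ∙-cong = λ p q n → +-cong (p n) (q n)
                  }
                ; assoc = λ _ _ _ _ → +-assoc _ _ _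
                }
              ; identity = (λ _ _ → +-identityˡ _) , (λ _ _ → +-identityʳ _)
              }
            ; inverse = (λ _ _ → -‿inverseˡ _) , (λ _ _ → -‿inverseʳ _)
            ; ⁻¹-cong = λ p n → -‿cong (p n)
            }
          ; comm = λ _ _ _ → +-comm _ _
          }
        ; *-cong = ⊗-cong
        ; *-assoc = ⊗-assoc
        ; *-identity = ⊗-identityˡ , λ g n → trans (⊗-comm g (const 1#) n) (⊗-identityˡ g n)
        ; distrib = ⊗-distribˡ , ⊗-distribʳ
        }
      ; *-comm = ⊗-comm
      }
    }

module _ where
  open import Data.Nat using (_+_; _*_)
  open import Data.Nat.Properties
  open ≡ using (refl; sym; trans; cong; cong₂; subst; subst₂; module ≡-Reasoning)

  -- Finite sets and their cardinalities

  record Enumeration {A : Set} (P : A → Set) (n : ℕ) : Set where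
    field
      list     : List A
      length≡  : length list ≡ n
      unique   : Unique list
      sound    : ∀ {x} → x ∈ list → P x
      complete : ∀ {x} → P x → x ∈ list
  open Enumeration

  module _ {A : Set} where

    -- Duplicate-free lists with the same members are equal as bags, hence permutations of each
    -- other. Bijections and case splits thereby become equations between counts.
    Enumeration-unique : ∀ {P : A → Set} {m n} → Enumeration P m → Enumeration P n → m ≡ n
    Enumeration-unique e e′ = trans (sym (length≡ e)) (trans (↭-length (∼bag⇒↭
      (unique∧set⇒bag (unique e) (unique e′)
        (mk⇔ (λ x∈ → complete e′ (sound e x∈)) (λ x∈ → complete e (sound e′ x∈))))))
      (length≡ e′))

    empty : ∀ {P : A → Set} → (∀ {x} → ¬ P x) → Enumeration P 0
    empty ¬P = record
      { list = [] ; length≡ = refl ; unique = []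
      ; sound = λ () ; complete = λ p → ⊥-elim (¬P p) }

    singleton : ∀ {P : A → Set} x → P x → (∀ {y} → P y → y ≡ x) → Enumeration P 1
    singleton {P} x p only = record
      { list = x ∷ [] ; length≡ = refl ; unique = [] ∷ []
      ; sound = λ { (here refl) → p } ; complete = λ q → here (only q) }

    disjointUnion : ∀ {P Q R : A → Set} {m n} → (∀ {x} → P x → Q x ⊎ R x) →
                    (∀ {x} → Q x → P x) → (∀ {x} → R x → P x) → (∀ {x} → Q x → ¬ R x) →
                    Enumeration Q m → Enumeration R n → Enumeration P (m + n)
    disjointUnion split left right disjoint e e′ = record
      { list     = list e ++ list e′
      ; length≡  = trans (List.length-++ (list e)) (cong₂ _+_ (length≡ e) (length≡ e′))
      ; unique   = Unique.++⁺ (unique e) (unique e′) λ (x∈ , x∈′) → disjoint (sound e x∈) (sound e′ x∈′)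
      ; sound    = λ x∈ → [ (λ x∈ → left (sound e x∈)) , (λ x∈ → right (sound e′ x∈)) ]
                            (∈-++⁻ (list e) x∈)
      ; complete = λ p → [ (λ q → ∈-++⁺ˡ (complete e q)) , (λ r → ∈-++⁺ʳ (list e) (complete e′ r)) ]
                            (split p)
      }

    transport : ∀ {P Q : A → Set} {n} (f g : A → A) →
                (∀ {x} → P x → Q (f x)) → (∀ {y} → Q y → P (g y)) →
                (∀ {x} → P x → g (f x) ≡ x) → (∀ {y} → Q y → f (g y) ≡ y) →
                Enumeration P n → Enumeration Q n
    transport {Q = Q} f g P⇒Q Q⇒P gf fg e = record
      { list     = map f (list e)
      ; length≡  = trans (List.length-map f (list e)) (length≡ e)
      -- `f` is invertible only on `P`, so distinctness is reflected along `g`, which maps the new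
      -- list back to the old one.
      ; unique   = Unique.map⁻ {f = g} (subst Unique (sym map-g-f) (unique e))
      ; sound    = λ y∈ → let x , x∈ , y≡fx = ∈-map⁻ f y∈ in subst Q (sym y≡fx) (P⇒Q (sound e x∈))
      ; complete = λ q → subst (_∈ map f (list e)) (fg q) (∈-map⁺ f (complete e (Q⇒P q)))
      }
      where
      map-g-f : map g (map f (list e)) ≡ list e
      map-g-f = trans (sym (List.map-∘ (list e))) (List.map-id-local (All.tabulate (λ x∈ → gf (sound e x∈))))

  -- Pairs of partitions of profile (3,1)

  Positive : List ℕ → Set
  Positive = All (1 ≤_)

  -- With `xs = ys` and `k = 1` this says weakly decreasing, so one relation serves for the order
  -- within each partition and for both cylindric conditions.
  Dominates : ℕ → List ℕ → List ℕ → Set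
  Dominates k xs ys = ∀ j → at ys (j + k) ≤ at xs j

  at-positive : ∀ {xs j} → Positive xs → j < length xs → 1 ≤ at xs j
  at-positive {x ∷ xs} {zero}  (p ∷ _)  _         = p
  at-positive {x ∷ xs} {suc j} (_ ∷ ps) (s≤s j<n) = at-positive ps j<n

  at-beyond : ∀ xs {j} → length xs ≤ j → at xs j ≡ 0
  at-beyond []       _         = refl
  at-beyond (x ∷ xs) (s≤s n≤j) = at-beyond xs n≤j

  at-injective : ∀ {xs ys} → Positive xs → Positive ys → (∀ j → at xs j ≡ at ys j) → xs ≡ ys
  at-injective []       []       _  = refl
  at-injective []       (q ∷ _)  eq = ⊥-elim (<⇒≢ q (eq 0))
  at-injective (p ∷ _)  []       eq = ⊥-elim (<⇒≢ p (sym (eq 0)))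
  at-injective (p ∷ ps) (q ∷ qs) eq = cong₂ _∷_ (eq 0) (at-injective ps qs (λ j → eq (suc j)))

  at≤head : ∀ xs → Dominates 1 xs xs → ∀ j → at xs j ≤ at xs 0
  at≤head xs d zero    = ≤-refl
  at≤head xs d (suc j) = ≤-trans (subst (λ i → at xs i ≤ at xs j) (+-comm j 1) (d j)) (at≤head xs d j)

  -- Adds 1 to each of the first a parts, counting zero parts; unbump undoes it for a = length xs.
  bump : ℕ → List ℕ → List ℕ
  bump zero    xs       = xs
  bump (suc a) []       = 1 ∷ bump a []
  bump (suc a) (x ∷ xs) = suc x ∷ bump a xs

  -- Cutting at the first zero keeps the parts positive whatever the list; in a weakly decreasing
  -- list only zeros are lost.
  consNonzero : ℕ → List ℕ → List ℕ
  consNonzero zero    _  = []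
  consNonzero (suc x) xs = suc x ∷ xs

  unbump : List ℕ → List ℕ
  unbump []       = []
  unbump (x ∷ xs) = consNonzero (pred x) (unbump xs)

  at-bump-< : ∀ a xs {j} → j < a → at (bump a xs) j ≡ suc (at xs j)
  at-bump-< (suc a) []       {zero}  _         = refl
  at-bump-< (suc a) []       {suc j} (s≤s j<a) = at-bump-< a [] j<a
  at-bump-< (suc a) (x ∷ xs) {zero}  _         = refl
  at-bump-< (suc a) (x ∷ xs) {suc j} (s≤s j<a) = at-bump-< a xs j<a

  at-bump-≥ : ∀ a xs {j} → a ≤ j → at (bump a xs) j ≡ at xs j
  at-bump-≥ zero    xs       _         = refl
  at-bump-≥ (suc a) []       (s≤s a≤j) = at-bump-≥ a [] a≤j
  at-bump-≥ (suc a) (x ∷ xs) (s≤s a≤j) = at-bump-≥ a xs a≤j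

  at-bump-≤ : ∀ a xs j → at (bump a xs) j ≤ suc (at xs j)
  at-bump-≤ a xs j with j <? a
  ... | yes j<a = ≤-reflexive (at-bump-< a xs j<a)
  ... | no  j≮a = m≤n⇒m≤1+n (≤-reflexive (at-bump-≥ a xs (≮⇒≥ j≮a)))

  -- At a position `j < a` the right side grows by 1 and the left by at most 1. At `j ≥ a` the bound
  -- gives `b ≤ j + k`, so neither side changes. With the shifts 1 and 3 this is the origin of the
  -- strip -1 ≤ a - b ≤ 3.
  bump-dominates : ∀ {k a b xs ys} → b ≤ k + a → Dominates k xs ys → Dominates k (bump a xs) (bump b ys)
  bump-dominates {k} {a} {b} {xs} {ys} b≤k+a d j with j <? a
  ... | yes j<a = ≤-trans (at-bump-≤ b ys (j + k))
                          (≤-trans (s≤s (d j)) (≤-reflexive (sym (at-bump-< a xs j<a))))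
  ... | no  j≮a = subst₂ _≤_ (sym (at-bump-≥ b ys b≤j+k)) (sym (at-bump-≥ a xs a≤j)) (d j)
    where
    a≤j = ≮⇒≥ j≮a
    b≤j+k : b ≤ j + k
    b≤j+k = ≤-trans b≤k+a (subst (k + a ≤_) (+-comm k j) (+-monoʳ-≤ k a≤j))

  bump-positive : ∀ a {xs} → Positive xs → Positive (bump a xs)
  bump-positive zero    ps       = ps
  bump-positive (suc a) []       = s≤s z≤n ∷ bump-positive a []
  bump-positive (suc a) (_ ∷ ps) = s≤s z≤n ∷ bump-positive a ps

  length-bump : ∀ a xs → length xs ≤ a → length (bump a xs) ≡ a
  length-bump zero    []       _         = refl
  length-bump (suc a) []       _         = cong suc (length-bump a [] z≤n)
  length-bump (suc a) (x ∷ xs) (s≤s n≤a) = cong suc (length-bump a xs n≤a)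

  sum-bump : ∀ a xs → sum (bump a xs) ≡ a + sum xs
  sum-bump zero    xs       = refl
  sum-bump (suc a) []       = cong suc (sum-bump a [])
  sum-bump (suc a) (x ∷ xs) = cong suc (trans (cong (λ n → x + n) (sum-bump a xs))
    (solve 3 (λ x a s → x :+ (a :+ s) := a :+ (x :+ s)) refl x a (sum xs)))
    where open +-*-Solver

  unbump-bump : ∀ a {xs} → Positive xs → length xs ≤ a → unbump (bump a xs) ≡ xs
  unbump-bump zero    []                     _         = refl
  unbump-bump (suc a) []                     _         = refl
  unbump-bump (suc a) (_∷_ {x = suc x} _ ps) (s≤s n≤a) = cong (suc x ∷_) (unbump-bump a ps n≤a)

  unbump-positive : ∀ xs → Positive (unbump xs)
  unbump-positive []                 = []
  unbump-positive (zero ∷ xs)        = []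
  unbump-positive (suc zero ∷ xs)    = []
  unbump-positive (suc (suc x) ∷ xs) = s≤s z≤n ∷ unbump-positive xs

  length-unbump : ∀ xs → length (unbump xs) ≤ length xs
  length-unbump []                 = z≤n
  length-unbump (zero ∷ xs)        = z≤n
  length-unbump (suc zero ∷ xs)    = z≤n
  length-unbump (suc (suc x) ∷ xs) = s≤s (length-unbump xs)

  at-unbump : ∀ xs → Dominates 1 xs xs → ∀ j → at (unbump xs) j ≡ pred (at xs j)
  at-unbump []                 d j       = refl
  at-unbump (zero ∷ xs)        d j       = sym (cong pred (n≤0⇒n≡0 (at≤head (zero ∷ xs) d j)))
  at-unbump (suc zero ∷ xs)    d j       = sym (n≤0⇒n≡0 (pred-mono-≤ (at≤head (suc zero ∷ xs) d j)))
  at-unbump (suc (suc x) ∷ xs) d zero    = refl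
  at-unbump (suc (suc x) ∷ xs) d (suc j) = at-unbump xs (λ i → d (suc i)) j

  unbump-dominates : ∀ k xs ys → Dominates 1 xs xs → Dominates 1 ys ys →
                     Dominates k xs ys → Dominates k (unbump xs) (unbump ys)
  unbump-dominates k xs ys dx dy d j =
    subst₂ _≤_ (sym (at-unbump ys dy (j + k))) (sym (at-unbump xs dx j)) (pred-mono-≤ (d j))

  bump-unbump : ∀ {xs} → Positive xs → Dominates 1 xs xs → bump (length xs) (unbump xs) ≡ xs
  bump-unbump {xs} ps d = at-injective (bump-positive (length xs) (unbump-positive xs)) ps agree
    where
    agree : ∀ j → at (bump (length xs) (unbump xs)) j ≡ at xs j
    agree j with j <? length xs
    ... | yes j<n = trans (at-bump-< (length xs) (unbump xs) j<n)
                      (trans (cong suc (at-unbump xs d j))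
                             (suc-pred (at xs j) {{>-nonZero (at-positive ps j<n)}}))
    ... | no  j≮n = trans (at-bump-≥ (length xs) (unbump xs) (≮⇒≥ j≮n))
                      (trans (at-unbump xs d j) (trans (cong pred beyond) (sym beyond)))
      where beyond = at-beyond xs (≮⇒≥ j≮n)

  -- Cylindric pairs sorted by their numbers of parts.

  record Cylindric (N : ℕ) (Λ : List ℕ × List ℕ) : Set where
    constructor cyl
    field
      positive₁   : Positive (proj₁ Λ)
      positive₂   : Positive (proj₂ Λ)
      decreasing₁ : Dominates 1 (proj₁ Λ) (proj₁ Λ)
      decreasing₂ : Dominates 1 (proj₂ Λ) (proj₂ Λ)
      dominates₁₂ : Dominates 1 (proj₁ Λ) (proj₂ Λ)
      dominates₂₁ : Dominates 3 (proj₂ Λ) (proj₁ Λ)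
      total       : sum (proj₁ Λ) + sum (proj₂ Λ) ≡ N

  -- The strict bounds make boxes with a = 0 or b = 0 empty, so that the recurrence needs no boundary case.
  Box Edge Full : ℕ → ℕ → ℕ → List ℕ × List ℕ → Set
  Box  a b N Λ = Cylindric N Λ × length (proj₁ Λ) < a × length (proj₂ Λ) < b
  Edge a b N Λ = Cylindric N Λ × length (proj₁ Λ) ≡ a × length (proj₂ Λ) < b
  Full a b N Λ = Cylindric N Λ × length (proj₁ Λ) ≡ a × length (proj₂ Λ) ≡ b

  -- The last summand stands in front, so that a box unfolds by computation into its last edge and
  -- the smaller box.
  sumBelow : (ℕ → ℕ) → ℕ → ℕ
  sumBelow f zero    = 0
  sumBelow f (suc n) = f n + sumBelow f n

  enumerate-edge : ∀ {f a N} → (∀ b → Enumeration (Full a b N) (f b)) →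
                   ∀ b → Enumeration (Edge a b N) (sumBelow f b)
  enumerate-edge full zero    = empty λ (_ , _ , l<0) → n≮0 l<0
  enumerate-edge full (suc b) = disjointUnion
    (λ (c , l₁ , l₂) → [ (λ l₂<b → inj₂ (c , l₁ , l₂<b)) , (λ l₂≡b → inj₁ (c , l₁ , l₂≡b)) ]
                       (m<1+n⇒m<n∨m≡n l₂))
    (λ (c , l₁ , l₂) → c , l₁ , s≤s (≤-reflexive l₂))
    (λ (c , l₁ , l₂) → c , l₁ , m<n⇒m<1+n l₂)
    (λ (_ , _ , l₂≡b) (_ , _ , l₂<b) → <⇒≢ l₂<b l₂≡b)
    (full b) (enumerate-edge full b)

  enumerate-box : ∀ {f b N} → (∀ a → Enumeration (Edge a b N) (f a)) →
                  ∀ a → Enumeration (Box a b N) (sumBelow f a)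
  enumerate-box edge zero    = empty λ (_ , l<0 , _) → n≮0 l<0
  enumerate-box edge (suc a) = disjointUnion
    (λ (c , l₁ , l₂) → [ (λ l₁<a → inj₂ (c , l₁<a , l₂)) , (λ l₁≡a → inj₁ (c , l₁≡a , l₂)) ]
                       (m<1+n⇒m<n∨m≡n l₁))
    (λ (c , l₁ , l₂) → c , s≤s (≤-reflexive l₁) , l₂)
    (λ (c , l₁ , l₂) → c , m<n⇒m<1+n l₁ , l₂)
    (λ (_ , l₁≡a , _) (_ , l₁<a , _) → <⇒≢ l₁<a l₁≡a)
    (edge a) (enumerate-box edge a)

  -- The second partition would have a positive part at index `a + 1`, yet that part is bounded by
  -- the entry of the first at index `a`, already past its end.
  ¬full-wide : ∀ {a b N Λ} → 1 + a < b → ¬ Full a b N Λ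
  ¬full-wide {a} {b} {N} {xs , ys} 1+a<b (c , refl , refl) =
    <⇒≱ tip>0 (≤-trans (dominates₁₂ a) (≤-reflexive (at-beyond xs ≤-refl)))
    where
    open Cylindric c
    tip>0 : 1 ≤ at ys (a + 1)
    tip>0 = at-positive positive₂ (subst (_< b) (+-comm 1 a) 1+a<b)

  ¬full-tall : ∀ {a b N Λ} → 3 + b < a → ¬ Full a b N Λ
  ¬full-tall {a} {b} {N} {xs , ys} 3+b<a (c , refl , refl) =
    <⇒≱ tip>0 (≤-trans (dominates₂₁ b) (≤-reflexive (at-beyond ys ≤-refl)))
    where
    open Cylindric c
    tip>0 : 1 ≤ at xs (b + 3)
    tip>0 = at-positive positive₁ (subst (_< a) (+-comm 3 b) 3+b<a)

  suc-square : ∀ j → suc j * suc j ≡ 1 + (2 * j + j * j)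
  suc-square = solve 1 (λ j → (con 1 :+ j) :* (con 1 :+ j) := con 1 :+ (con 2 :* j :+ j :* j)) refl
    where open +-*-Solver

  interchange : ∀ a b x y → (a + x) + (b + y) ≡ (a + b) + (x + y)
  interchange = solve 4 (λ a b x y → (a :+ x) :+ (b :+ y) := (a :+ b) :+ (x :+ y)) refl
    where open +-*-Solver

  bump² : ℕ → ℕ → List ℕ × List ℕ → List ℕ × List ℕ
  bump² a b (xs , ys) = bump a xs , bump b ys

  unbump² : List ℕ × List ℕ → List ℕ × List ℕ
  unbump² (xs , ys) = unbump xs , unbump ys

  bump²-full : ∀ {a b M Λ} → b ≤ 1 + a → a ≤ 3 + b → 
               Box (suc a) (suc b) M Λ → Full a b (a + b + M) (bump² a b Λ)
  bump²-full {a} {b} {M} {xs , ys} b≤1+a a≤3+b (cyl p₁ p₂ d₁ d₂ d₁₂ d₂₁ total , l₁ , l₂) =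
    cyl (bump-positive a p₁) (bump-positive b p₂)
        (bump-dominates {1} (n≤1+n a) d₁) (bump-dominates {1} (n≤1+n b) d₂)
        (bump-dominates {1} b≤1+a d₁₂) (bump-dominates {3} a≤3+b d₂₁)
        (trans (cong₂ _+_ (sum-bump a xs) (sum-bump b ys))
          (trans (interchange a b (sum xs) (sum ys)) (cong (λ n → a + b + n) total))) ,
    length-bump a xs (s≤s⁻¹ l₁) , length-bump b ys (s≤s⁻¹ l₂)

  full-bump-unbump : ∀ {a b N Λ} → Full a b N Λ → bump² a b (unbump² Λ) ≡ Λ
  full-bump-unbump (cyl p₁ p₂ d₁ d₂ _ _ _ , refl , refl) = cong₂ _,_ (bump-unbump p₁ d₁) (bump-unbump p₂ d₂)

  -- Removing 1 from each of the `a + b` parts lowers the size by exactly `a + b`. This gives the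
  -- size of the unbumped pair and also excludes sizes below `a + b`.
  full-total : ∀ {a b N Λ} → Full a b N Λ → a + b + (sum (unbump (proj₁ Λ)) + sum (unbump (proj₂ Λ))) ≡ N
  full-total {a} {b} {N} {xs , ys} full@(c , _) = begin
    a + b + (sum (unbump xs) + sum (unbump ys))  ≡⟨ sym (interchange a b _ _) ⟩
    (a + sum (unbump xs)) + (b + sum (unbump ys))
      ≡⟨ sym (cong₂ _+_ (sum-bump a _) (sum-bump b _)) ⟩
    sum (bump a (unbump xs)) + sum (bump b (unbump ys))
      ≡⟨ cong (λ Λ → sum (proj₁ Λ) + sum (proj₂ Λ)) (full-bump-unbump full) ⟩
    sum xs + sum ys  ≡⟨ Cylindric.total c ⟩
    N  ∎
    where open ≡-Reasoning

  unbump²-box : ∀ {a b M Λ} → Full a b (a + b + M) Λ → Box (suc a) (suc b) M (unbump² Λ)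
  unbump²-box {a} {b} {M} {xs , ys} full@(cyl p₁ p₂ d₁ d₂ d₁₂ d₂₁ _ , l₁ , l₂) =
    cyl (unbump-positive xs) (unbump-positive ys)
        (unbump-dominates 1 xs xs d₁ d₁ d₁) (unbump-dominates 1 ys ys d₂ d₂ d₂)
        (unbump-dominates 1 xs ys d₁ d₂ d₁₂) (unbump-dominates 3 ys xs d₂ d₁ d₂₁)
        (+-cancelˡ-≡ (a + b) _ _ (full-total full)) ,
    s≤s (≤-trans (length-unbump xs) (≤-reflexive l₁)) , s≤s (≤-trans (length-unbump ys) (≤-reflexive l₂))

  -- Subtracting 1 deletes the parts equal to 1, so the image is the whole box of pairs with at most
  -- `a` and `b` parts.
  enumerate-full : ∀ {a b M n} → b ≤ 1 + a → a ≤ 3 + b →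
                   Enumeration (Box (suc a) (suc b) M) n → Enumeration (Full a b (a + b + M)) n
  enumerate-full {a} {b} b≤1+a a≤3+b = transport (bump² a b) unbump²
    (bump²-full b≤1+a a≤3+b) unbump²-box
    (λ (c , l₁ , l₂) → cong₂ _,_ (unbump-bump a (Cylindric.positive₁ c) (s≤s⁻¹ l₁))
                                 (unbump-bump b (Cylindric.positive₂ c) (s≤s⁻¹ l₂)))
    full-bump-unbump

  ¬full-small : ∀ {a b N Λ} → N < a + b → ¬ Full a b N Λ
  ¬full-small {a} {b} N<a+b full = <⇒≱ N<a+b (subst (a + b ≤_) (full-total full) (m≤m+n (a + b) _))

  []-full : Full 0 0 0 ([] , [])
  []-full = cyl [] [] (λ _ → z≤n) (λ _ → z≤n) (λ _ → z≤n) (λ _ → z≤n) refl , refl , refl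

  full-[] : ∀ {N Λ} → Full 0 0 N Λ → Λ ≡ ([] , []) × N ≡ 0
  full-[] {Λ = [] , []} (c , _) = refl , sym (Cylindric.total c)

  enumerate-origin : ∀ N → ∃[ n ] Enumeration (Full 0 0 N) n
  enumerate-origin zero    = 1 , singleton _ []-full (λ full → proj₁ (full-[] full))
  enumerate-origin (suc N) = 0 , empty (λ full → 1+n≢0 (proj₂ (full-[] full)))

  -- Strong induction on the size: inside the strip the pairs correspond to a box of size N - (a +
  -- b), which is a disjoint union of sets of full pairs of that size.
  full-enumeration : ∀ N a b → ∃[ n ] Enumeration (Full a b N) n
  full-enumeration = <-rec _ step
    where
    step : ∀ N → (∀ {M} → M < N → ∀ a b → ∃[ n ] Enumeration (Full a b M) n) →
           ∀ a b → ∃[ n ] Enumeration (Full a b N) n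
    step N rec a b with a + b in a+b≡ | b ≤? 1 + a | a ≤? 3 + b
    ... | _     | no b≰  | _      = 0 , empty (¬full-wide (≰⇒> b≰))
    ... | _     | _      | no a≰  = 0 , empty (¬full-tall (≰⇒> a≰))
    -- For `a = b = 0` the bijection does not lower the size, so this case is enumerated directly;
    -- only the empty pair can occur.
    ... | zero  | yes b≤ | yes a≤ with refl ← m+n≡0⇒m≡0 a a+b≡ | refl ← m+n≡0⇒n≡0 a a+b≡ = enumerate-origin N
    ... | suc s | yes b≤ | yes a≤ with suc s ≤? N
    ...   | no  s≰N = 0 , empty (¬full-small (subst (N <_) (sym a+b≡) (≰⇒> s≰N)))
    ...   | yes s≤N with m , refl ← m≤n⇒∃[o]m+o≡n s≤N =
      let smaller = rec (s≤s (m≤n+m m s))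
          n       = sumBelow (λ i → sumBelow (λ j → proj₁ (smaller i j)) (suc b)) (suc a)
      in n , subst (λ k → Enumeration (Full a b (k + m)) n) a+b≡ (enumerate-full b≤ a≤
        (enumerate-box (λ i → enumerate-edge (λ j → proj₂ (smaller i j)) (suc b)) (suc a)))

  -- Counting functions and their identities.

  full : ℕ → ℕ → ℕ → ℕ
  full a b N = proj₁ (full-enumeration N a b)

  edge box : ℕ → ℕ → ℕ → ℕ
  edge a b N = sumBelow (λ b → full a b N) b
  box  a b N = sumBelow (λ a → edge a b N) a

  box-enumeration : ∀ a b N → Enumeration (Box a b N) (box a b N)
  box-enumeration a b N = enumerate-box (λ a → enumerate-edge (λ b → proj₂ (full-enumeration N a b)) b) a

  -- The counts come out of a well-founded recursion; rather than unfolding it, each value is found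
  -- by exhibiting another enumeration of the same set.
  full-≡ : ∀ {a b N n} → Enumeration (Full a b N) n → full a b N ≡ n
  full-≡ {a} {b} {N} = Enumeration-unique (proj₂ (full-enumeration N a b))

  full-0-0-0 : full 0 0 0 ≡ 1
  full-0-0-0 = full-≡ (proj₂ (enumerate-origin 0))

  full-0-0-suc : ∀ N → full 0 0 (suc N) ≡ 0
  full-0-0-suc N = full-≡ (proj₂ (enumerate-origin (suc N)))

  full-wide : ∀ {a b} N → 1 + a < b → full a b N ≡ 0
  full-wide {a} {b} N h = full-≡ {a} {b} {N} (empty (¬full-wide h))

  full-tall : ∀ {a b} N → 3 + b < a → full a b N ≡ 0
  full-tall {a} {b} N h = full-≡ {a} {b} {N} (empty (¬full-tall h))

  full-small : ∀ {a b N} → N < a + b → full a b N ≡ 0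
  full-small {a} {b} h = full-≡ {a} {b} (empty (¬full-small h))

  full-shift : ∀ {a b} M → b ≤ 1 + a → a ≤ 3 + b → full a b (a + b + M) ≡ box (suc a) (suc b) M
  full-shift {a} {b} M b≤ a≤ = full-≡ {a} {b} (enumerate-full b≤ a≤ (box-enumeration (suc a) (suc b) M))

  sumBelow-0 : ∀ f n → (∀ i → i < n → f i ≡ 0) → sumBelow f n ≡ 0
  sumBelow-0 f zero    h = refl
  sumBelow-0 f (suc n) h = cong₂ _+_ (h n ≤-refl) (sumBelow-0 f n (λ i i<n → h i (m<n⇒m<1+n i<n)))

  -- The pairs gained would have `b` parts in the second partition and so at least `b - 1` in the
  -- first, but the box allows fewer than `a ≤ b - 1`.
  box-widen : ∀ {a b} N → a < b → box a (suc b) N ≡ box a b N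
  box-widen {zero}  {b} N _   = refl
  box-widen {suc a} {b} N a<b = cong₂ _+_
    (cong (_+ edge a b N) (full-wide N a<b)) (box-widen N (<-trans (n<1+n a) a<b))

  -- The pairs gained would have `a` parts in the first partition and so at least `a - 3 ≥ b` in the
  -- second, but the box allows fewer than `b`.
  box-heighten : ∀ {a b} N → 3 + b ≤ a → box (suc a) b N ≡ box a b N
  box-heighten {a} {b} N 3+b≤a = cong (_+ box a b N)
    (sumBelow-0 _ b (λ i i<b → full-tall N (<-≤-trans (+-monoʳ-< 3 i<b) 3+b≤a)))

  -- From enumerations to a bijection with `Fin`.

  index-lookup : ∀ {A : Set} {xs : List A} → Unique xs → ∀ i (p : List.lookup xs i ∈ xs) → index p ≡ i
  index-lookup _        zero    (here _)  = refl
  index-lookup (x∉ ∷ _) zero    (there p) = ⊥-elim (All.lookup x∉ p refl)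
  index-lookup (x∉ ∷ _) (suc i) (here eq) = ⊥-elim (All.lookup x∉ (∈-lookup i) (sym eq))
  index-lookup (_ ∷ u)  (suc i) (there p) = cong suc (index-lookup u i p)

  open DecMembership (Product.≡-dec (List.≡-dec ℕ._≟_) (List.≡-dec ℕ._≟_)) using (_∈?_)

  linked⇒dominates : ∀ {xs} → Linked _≥_ xs → Dominates 1 xs xs
  linked⇒dominates []              j       = z≤n
  linked⇒dominates [-]             zero    = z≤n
  linked⇒dominates [-]             (suc j) = z≤n
  linked⇒dominates (x≥y ∷ _)       zero    = x≥y
  linked⇒dominates (_ ∷ l)         (suc j) = linked⇒dominates l j

  dominates⇒linked : ∀ xs → Dominates 1 xs xs → Linked _≥_ xs
  dominates⇒linked []           _ = []
  dominates⇒linked (x ∷ [])     _ = [-]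
  dominates⇒linked (x ∷ y ∷ xs) d = d 0 ∷ dominates⇒linked (y ∷ xs) (λ j → d (suc j))

  length≤sum : ∀ {xs} → Positive xs → length xs ≤ sum xs
  length≤sum []       = z≤n
  length≤sum (p ∷ ps) = +-mono-≤ p (length≤sum ps)

  -- Size `N` allows at most `N` parts in each partition. The bound is doubled so that the box is
  -- the one on diagonal 1 at `k = N + N`, far enough out for `q²Poch*rrConv-stable`.
  Cylindric⇒Box : ∀ {N Λ} → Cylindric N Λ → Box (2 + (N + N)) (1 + (N + N)) N Λ
  Cylindric⇒Box {N} {xs , ys} c =
    c , m≤n⇒m≤1+n (s≤s (bound xs positive₁ (m≤m+n _ _))) , s≤s (bound ys positive₂ (m≤n+m _ (sum xs)))
    where
    open Cylindric c
    bound : ∀ zs → Positive zs → sum zs ≤ sum xs + sum ys → length zs ≤ N + N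
    bound zs ps sum≤ = ≤-trans (length≤sum ps) (≤-trans sum≤ (≤-trans (≤-reflexive total) (m≤m+n N N)))

  pair : ∀ {N} → CylPartOfSize profile31 N → List ℕ × List ℕ
  pair (mkCyl (λ₁ ∷ λ₂ ∷ []) _ _) = parts λ₁ , parts λ₂

  unpair : ∀ {N} Λ → .(Cylindric N Λ) → CylPartOfSize profile31 N
  unpair {N} (xs , ys) c = mkCyl
    (mkPartition xs (dominates⇒linked xs (Cylindric.decreasing₁ c)) (Cylindric.positive₁ c) ∷
     mkPartition ys (dominates⇒linked ys (Cylindric.decreasing₂ c)) (Cylindric.positive₂ c) ∷ [])
    (λ { zero j → Cylindric.dominates₁₂ c j ; (suc zero) j → Cylindric.dominates₂₁ c j })
    (trans (cong (λ n → sum xs + n) (+-identityʳ (sum ys))) (Cylindric.total c))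

  unpair-cong : ∀ {N Λ Λ′} → Λ ≡ Λ′ → .(c : Cylindric N Λ) .(c′ : Cylindric N Λ′) → unpair Λ c ≡ unpair Λ′ c′
  unpair-cong refl _ _ = refl

  pair-cylindric : ∀ {N} (Λ : CylPartOfSize profile31 N) → Irrelevant (Cylindric N (pair Λ))
  pair-cylindric (mkCyl (mkPartition xs dx px ∷ mkPartition ys dy py ∷ []) cylindric size≡) =
    squash (cyl px py (linked⇒dominates dx) (linked⇒dominates dy) (cylindric zero) (cylindric (suc zero))
        (trans (cong (λ n → sum xs + n) (sym (+-identityʳ (sum ys)))) size≡))

  unpair-pair : ∀ {N} (Λ : CylPartOfSize profile31 N) .(c : Cylindric N (pair Λ)) → unpair (pair Λ) c ≡ Λ
  unpair-pair (mkCyl (_ ∷ _ ∷ []) _ _) _ = refl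

  enumeration⇒↔ : ∀ {N m} → Enumeration (Cylindric N) m → CylPartOfSize profile31 N ↔ Fin m
  enumeration⇒↔ {N} e = subst (λ m → CylPartOfSize profile31 N ↔ Fin m) (length≡ e)
    (mk↔ₛ′ to from (λ i → index-lookup (unique e) i (pair∈ (from i)))
      (λ Λ → trans (unpair-cong (sym (lookup-index (pair∈ Λ))) (sound e (∈-lookup (to Λ))) (sound e (pair∈ Λ)))
                   (unpair-pair Λ (sound e (pair∈ Λ)))))
    where
    open Enumeration
    pair∈ : ∀ Λ → pair Λ ∈ list e
    -- The proofs inside a `CylPartOfSize` are irrelevant and give membership only irrelevantly;
    -- since membership in the list is decidable, it can be recomputed.
    pair∈ Λ with squash c ← pair-cylindric Λ = recompute (pair Λ ∈? list e) (complete e c)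
    to : CylPartOfSize profile31 N → Fin (length (list e))
    to Λ = index (pair∈ Λ)
    from : Fin (length (list e)) → CylPartOfSize profile31 N
    from i = unpair (List.lookup (list e) i) (sound e (∈-lookup i))

module _ where
  open PowerSeries ℤ.+-*-commutativeRing using (tail; const; const-⊗; ⊗-cong-≤)
    renaming (commutativeRingS to fpsRing)
  open CommutativeRing fpsRing
    using (_≈_; _+_; _*_; -_; _-_; 0#; 1#; +-comm; +-cong; +-congˡ; +-congʳ; +-identityˡ; +-identityʳ;
           *-cong; *-congˡ; *-congʳ; *-assoc; *-identityˡ; *-identityʳ; -‿cong; -‿inverseʳ;
           distribʳ; zeroˡ; zeroʳ; setoid)
    renaming (refl to ≈-refl; sym to ≈-sym; trans to ≈-trans)
  module ≈-Reasoning = SetoidReasoning setoid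

  -- Formal power series in q

  -- Embeds ℤ as the constant series, so that the ring solver can compare coefficients by deciding
  -- equality of integers.
  constHom : CommutativeRing.rawRing ℤ.+-*-commutativeRing -Raw-AlmostCommutative⟶ fromCommutativeRing fpsRing
  constHom = record
    { ⟦_⟧    = const
    ; +-homo = λ { a b zero → ≡.refl ; a b (suc _) → ≡.refl }
    ; *-homo = λ a b → ≈-sym (≈-trans (const-⊗ a (const b)) (λ { zero → ≡.refl ; (suc n) → ℤ.*-zeroʳ a }))
    ; -‿homo = λ { a zero → ≡.refl ; a (suc _) → ≡.refl }
    ; 0-homo = λ { zero → ≡.refl ; (suc _) → ≡.refl }
    ; 1-homo = λ _ → ≡.refl
    }

  const≟ : ∀ a b → Maybe (const a ≈ const b)
  const≟ a b = Maybe.map (λ a≡b n → ≡.cong (λ c → const c n) a≡b) (dec⇒maybe (a ℤ.≟ b))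

  open RingSolver _ (fromCommutativeRing fpsRing) constHom const≟
    using (solve; _:+_; _:*_; _:-_; :-_; _:=_; con)

  sumTo-suc : ∀ f n → sumTo f (suc n) ≡ f 0 ℤ.+ sumTo (λ i → f (suc i)) n
  sumTo-suc f zero    = ≡.refl
  sumTo-suc f (suc n) = ≡.trans (≡.cong (ℤ._+ f (suc (suc n))) (sumTo-suc f n)) (ℤ.+-assoc (f 0) _ _)

  -- Bridges the convolution used in the statement and the recursive product of the ring.
  ⊛≈* : ∀ f g → f ⊛ g ≈ f * g
  ⊛≈* f g zero    = ≡.refl
  ⊛≈* f g (suc n) = ≡.trans (sumTo-suc (λ i → f i ℤ.* g (suc n ∸ i)) n)
                            (≡.cong (ℤ._+_ (f 0 ℤ.* g (suc n))) (⊛≈* (tail f) g n))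

  oneS≈1# : oneS ≈ 1#
  oneS≈1# zero    = ≡.refl
  oneS≈1# (suc _) = ≡.refl

  X^_ : ℕ → FPS
  X^ n = mono (+ 1) n
  infix 9 X^_

  X^0≈1# : X^ 0 ≈ 1#
  X^0≈1# zero    = ≡.refl
  X^0≈1# (suc _) = ≡.refl

  X^suc-*-suc : ∀ k f n → (X^ suc k * f) (suc n) ≡ (X^ k * f) n
  X^suc-*-suc k f n = ℤ.+-identityˡ _

  X^*-< : ∀ k f {n} → n < k → (X^ k * f) n ≡ + 0
  X^*-< (suc k) f {zero}  _         = ≡.refl
  X^*-< (suc k) f {suc n} (s≤s n<k) = ≡.trans (X^suc-*-suc k f n) (X^*-< k f n<k)

  X^*-+ : ∀ k f n → (X^ k * f) (k ℕ.+ n) ≡ f n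
  X^*-+ zero    f n = ≈-trans (*-congʳ {f} X^0≈1#) (*-identityˡ f) n
  X^*-+ (suc k) f n = ≡.trans (X^suc-*-suc k f (k ℕ.+ n)) (X^*-+ k f n)

  X^-+ : ∀ m n → X^ (m ℕ.+ n) ≈ X^ m * X^ n
  X^-+ zero    n = ≈-sym (≈-trans (*-congʳ X^0≈1#) (*-identityˡ (X^ n)))
  X^-+ (suc m) n zero    = ≡.refl
  X^-+ (suc m) n (suc i) = ≡.trans (X^-+ m n i) (≡.sym (X^suc-*-suc m (X^ n) i))

  1-X^_ : ℕ → FPS
  1-X^ k = 1# - X^ k
  infix 9 1-X^_

  geomInv-+ : ∀ k n → geomInv k (k ℕ.+ n) ≡ geomInv k n
  geomInv-+ k n = ≡.cong (if_then (+ 1) else (+ 0))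
    (does-⇔ (mk⇔ (λ k∣k+n → ∣m+n∣m⇒∣n k∣k+n ∣-refl) (∣m∣n⇒∣m+n ∣-refl)) (k ∣? (k ℕ.+ n)) (k ∣? n))

  geomInv-< : ∀ {k n} → n < k → geomInv k n ≡ oneS n
  geomInv-< {k} {zero}  n<k = ≡.cong (if_then (+ 1) else (+ 0)) (dec-true (k ∣? 0) (k ∣0))
  geomInv-< {k} {suc n} n<k =
    ≡.cong (if_then (+ 1) else (+ 0)) (dec-false (k ∣? suc n) λ k∣n → ℕ.<⇒≱ n<k (∣⇒≤ k∣n))

  -- Below degree `k + 1` the geometric series agrees with 1 and its shifted copy vanishes; from
  -- there on, periodicity of the coefficients makes the two copies cancel.
  1-X^-inverse : ∀ k → 1-X^ suc k * geomInv (suc k) ≈ 1#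
  1-X^-inverse k n = ≡.trans (expand n) (coefficient (n ℕ.<? suc k))
    where
    g = geomInv (suc k)
    expand : 1-X^ suc k * g ≈ g - X^ suc k * g
    expand = solve 2 (λ x g → (con (+ 1) :- x) :* g := g :- x :* g) ≈-refl (X^ suc k) g
    coefficient : ∀ {n} → Dec (n < suc k) → g n ℤ.- (X^ suc k * g) n ≡ 1# n
    coefficient {n} (yes n<k) = ≡.trans (≡.cong₂ ℤ._-_ (geomInv-< n<k) (X^*-< (suc k) g n<k))
                                        (≡.trans (ℤ.+-identityʳ _) (oneS≈1# n))
    coefficient {n} (no n≮k) with ℕ.m≤n⇒∃[o]m+o≡n (ℕ.≮⇒≥ n≮k)
    ... | m , ≡.refl = ≡.trans (≡.cong₂ ℤ._-_ (geomInv-+ (suc k) m) (X^*-+ (suc k) g m))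
                               (ℤ.+-inverseʳ (g m))

  -- Finite products and q-Pochhammer symbols.

  prodTo-suc : ∀ F n → prodTo F (suc n) ≈ prodTo F n * F (suc n)
  prodTo-suc F n = ⊛≈* (prodTo F n) (F (suc n))

  prodTo-inverse : ∀ {F G} → (∀ k → F (suc k) * G (suc k) ≈ 1#) → ∀ n → prodTo F n * prodTo G n ≈ 1#
  prodTo-inverse {F} {G} h zero    = ≈-trans (*-cong oneS≈1# oneS≈1#) (*-identityˡ 1#)
  prodTo-inverse {F} {G} h (suc n) = begin
    prodTo F (suc n) * prodTo G (suc n)  ≈⟨ *-cong (prodTo-suc F n) (prodTo-suc G n) ⟩
    prodTo F n * F (suc n) * (prodTo G n * G (suc n))
      ≈⟨ solve 4 (λ a b c d → a :* b :* (c :* d) := a :* c :* (b :* d)) ≈-refl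
           (prodTo F n) (F (suc n)) (prodTo G n) (G (suc n)) ⟩
    prodTo F n * prodTo G n * (F (suc n) * G (suc n))  ≈⟨ *-cong (prodTo-inverse h n) (h n) ⟩
    1# * 1#  ≈⟨ *-identityˡ 1# ⟩
    1#  ∎
    where open ≈-Reasoning

  qPoch q²Poch negQ²Poch : ℕ → FPS
  qPoch = prodTo 1-X^_
  q²Poch = prodTo (λ k → 1-X^ (2 ℕ.* k))
  negQ²Poch = prodTo (λ k → onePlusQ (2 ℕ.* k))

  qPoch-inverse : ∀ n → qPoch n * prodTo geomInv n ≈ 1#
  qPoch-inverse = prodTo-inverse 1-X^-inverse

  q²Poch-inverse : ∀ n → q²Poch n * invQ2Poch n ≈ 1#
  -- `k + suc (k + 0)` is what `2 * suc k` computes to below its outer `suc`.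
  q²Poch-inverse = prodTo-inverse (λ k → 1-X^-inverse (k ℕ.+ suc (k ℕ.+ 0)))

  -- Power series in a second variable z.

  module O = PowerSeries fpsRing
  open O using (_≋_) renaming (_⊗_ to _⊠_)
  module OR = CommutativeRing O.commutativeRingS

  -- With p = q²: q^(j²)/(p;p)_j, (-p;p)_i/(p;p)_i and (-1;p)_i/(p;p)_i.
  rrTerm ratio ratio′ : ℕ → FPS
  rrTerm j = X^ (j ℕ.* j) * invQ2Poch j
  ratio i = negQ²Poch i * invQ2Poch i
  ratio′ zero    = 1#
  ratio′ (suc i) = (1# + 1#) * (negQ²Poch i * invQ2Poch (suc i))

  invQ2Poch-step : ∀ i → invQ2Poch i ≈ 1-X^ (2 ℕ.* suc i) * invQ2Poch (suc i)
  invQ2Poch-step i = begin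
    I  ≈⟨ ≈-sym (*-identityʳ I) ⟩
    I * 1#  ≈⟨ *-congˡ {I} (≈-sym (1-X^-inverse (i ℕ.+ suc (i ℕ.+ 0)))) ⟩
    I * (x * g) ≈⟨ solve 3 (λ I x g → I :* (x :* g) := x :* (I :* g)) ≈-refl I x g ⟩
    x * (I * g) ≈⟨ *-congˡ {x} (≈-sym (prodTo-suc (λ k → geomInv (2 ℕ.* k)) i)) ⟩
    x * invQ2Poch (suc i) ∎
    where
    open ≈-Reasoning
    I = invQ2Poch i
    x = 1-X^ (2 ℕ.* suc i)
    g = geomInv (2 ℕ.* suc i)

  negQ²Poch-suc : ∀ i → negQ²Poch (suc i) ≈ negQ²Poch i * (1# + X^ (2 ℕ.* suc i))
  negQ²Poch-suc i = ≈-trans (prodTo-suc (λ k → onePlusQ (2 ℕ.* k)) i)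
                            (*-congˡ {negQ²Poch i} (+-congʳ oneS≈1#))

  -- Write T(z), R(z), R′(z) for the series in z with coefficients `rrTerm`, `ratio`, `ratio′`, and
  -- p = q². This is R′(z) = (1 + z) R(z), where R′(z) = (-z;p)_∞/(z;p)_∞ by the q-binomial theorem.
  ratio′-suc : ∀ i → ratio′ (suc i) ≈ ratio (suc i) + ratio i
  ratio′-suc i = ≈-sym (begin
    negQ²Poch (suc i) * I + negQ²Poch i * invQ2Poch i
      ≈⟨ +-cong (*-congʳ {I} (negQ²Poch-suc i)) (*-congˡ {negQ²Poch i} (invQ2Poch-step i)) ⟩
    negQ²Poch i * (1# + x) * I + negQ²Poch i * ((1# - x) * I)
      ≈⟨ solve 3 (λ μ x I → μ :* (con (+ 1) :+ x) :* I :+ μ :* ((con (+ 1) :- x) :* I)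
                    := (con (+ 1) :+ con (+ 1)) :* (μ :* I)) ≈-refl (negQ²Poch i) x I ⟩
    (1# + 1#) * (negQ²Poch i * I)  ∎)
    where
    open ≈-Reasoning
    I = invQ2Poch (suc i)
    x = X^ (2 ℕ.* suc i)

  -- This is R′(z) - R′(pz) = 2z R(z): the factor 1 - p^(i+1) cancels the last factor of the
  -- denominator.
  ratio′-scale : ∀ i → ratio′ (suc i) - X^ (2 ℕ.* suc i) * ratio′ (suc i) ≈ (1# + 1#) * ratio i
  ratio′-scale i = begin
    (1# + 1#) * (negQ²Poch i * I) - x * ((1# + 1#) * (negQ²Poch i * I))
      ≈⟨ solve 3 (λ μ x I → let 2μ = (con (+ 1) :+ con (+ 1)) :* (μ :* I) in
                    2μ :- x :* 2μ := (con (+ 1) :+ con (+ 1)) :* (μ :* ((con (+ 1) :- x) :* I)))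
           ≈-refl (negQ²Poch i) x I ⟩
    (1# + 1#) * (negQ²Poch i * ((1# - x) * I))
      ≈⟨ *-congˡ {1# + 1#} (*-congˡ {negQ²Poch i} (≈-sym (invQ2Poch-step i))) ⟩
    (1# + 1#) * ratio i  ∎
    where
    open ≈-Reasoning
    I = invQ2Poch (suc i)
    x = X^ (2 ℕ.* suc i)

  -- This is T(z) = (1 + qz) T(pz), the functional equation of Euler's product T(z) = (-qz;p)_∞.
  rrTerm-scale : ∀ j → rrTerm (suc j) - X^ (2 ℕ.* suc j) * rrTerm (suc j) ≈ X^ 1 * (X^ (2 ℕ.* j) * rrTerm j)
  rrTerm-scale j = begin
    s * I - x * (s * I)
      ≈⟨ solve 3 (λ s x I → s :* I :- x :* (s :* I) := s :* ((con (+ 1) :- x) :* I)) ≈-refl s x I ⟩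
    s * ((1# - x) * I)  ≈⟨ *-congˡ {s} (≈-sym (invQ2Poch-step j)) ⟩
    s * invQ2Poch j  ≈⟨ *-congʳ {invQ2Poch j} square ⟩
    X^ 1 * (X^ (2 ℕ.* j) * X^ (j ℕ.* j)) * invQ2Poch j
      ≈⟨ solve 4 (λ q x s I → q :* (x :* s) :* I := q :* (x :* (s :* I))) ≈-refl
           (X^ 1) (X^ (2 ℕ.* j)) (X^ (j ℕ.* j)) (invQ2Poch j) ⟩
    X^ 1 * (X^ (2 ℕ.* j) * (X^ (j ℕ.* j) * invQ2Poch j)) ∎
    where
    open ≈-Reasoning
    s = X^ (suc j ℕ.* suc j)
    I = invQ2Poch (suc j)
    x = X^ (2 ℕ.* suc j)
    square : s ≈ X^ 1 * (X^ (2 ℕ.* j) * X^ (j ℕ.* j))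
    square = begin
      s
        ≡⟨ ≡.cong X^_ (suc-square j) ⟩
      X^ (1 ℕ.+ (2 ℕ.* j ℕ.+ j ℕ.* j))  ≈⟨ X^-+ 1 (2 ℕ.* j ℕ.+ j ℕ.* j) ⟩
      X^ 1 * X^ (2 ℕ.* j ℕ.+ j ℕ.* j)  ≈⟨ *-congˡ {X^ 1} (X^-+ (2 ℕ.* j) (j ℕ.* j)) ⟩
      X^ 1 * (X^ (2 ℕ.* j) * X^ (j ℕ.* j))  ∎

  shift : (ℕ → FPS) → ℕ → FPS
  shift f zero    = 0#
  shift f (suc k) = f k

  -- The substitution z ↦ q² z in a power series in z with coefficients in FPS.
  scale : (ℕ → FPS) → ℕ → FPS
  scale f k = X^ (2 ℕ.* k) * f k

  ⊠-shiftˡ : ∀ f g k → (shift f ⊠ g) (suc k) ≈ (f ⊠ g) k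
  ⊠-shiftˡ f g k = ≈-trans (+-congʳ (zeroˡ (g (suc k)))) (+-identityˡ _)

  ⊠-shiftʳ : ∀ f g k → (f ⊠ shift g) (suc k) ≈ (f ⊠ g) k
  ⊠-shiftʳ f g k = ≈-trans (O.⊗-comm f (shift g) (suc k)) (≈-trans (⊠-shiftˡ g f k) (O.⊗-comm g f k))

  ⊠-·ʳ : ∀ c f g → f ⊠ (c O.· g) ≋ c O.· (f ⊠ g)
  ⊠-·ʳ c f g k = ≈-trans (O.⊗-comm f (c O.· g) k) (≈-trans (O.·-⊗ c g f k) (*-congˡ {c} (O.⊗-comm g f k)))

  tail-scale : ∀ f → O.tail (scale f) ≋ X^ 2 O.· scale (O.tail f)
  tail-scale f k = begin
    X^ (2 ℕ.* suc k) * f (suc k)  ≡⟨ ≡.cong (λ i → X^ i * f (suc k)) (ℕ.*-suc 2 k) ⟩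
    X^ (2 ℕ.+ 2 ℕ.* k) * f (suc k)  ≈⟨ *-congʳ {f (suc k)} (X^-+ 2 (2 ℕ.* k)) ⟩
    X^ 2 * X^ (2 ℕ.* k) * f (suc k)  ≈⟨ *-assoc (X^ 2) (X^ (2 ℕ.* k)) (f (suc k)) ⟩
    X^ 2 * (X^ (2 ℕ.* k) * f (suc k))  ∎
    where open ≈-Reasoning

  -- In every term of the convolution the weights q^(2j) and q^(2(k-j)) multiply to q^(2k).
  scale-⊠ : ∀ f g → scale f ⊠ scale g ≋ scale (f ⊠ g)
  scale-⊠ f g zero = ≈-trans
    (solve 3 (λ x f g → x :* f :* (x :* g) := x :* x :* (f :* g)) ≈-refl (X^ 0) (f 0) (g 0))
    (*-congʳ {f 0 * g 0} (≈-trans (*-congʳ {X^ 0} X^0≈1#) (*-identityˡ (X^ 0))))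
  scale-⊠ f g (suc k) = begin
    X^ 0 * f 0 * (x * g (suc k)) + (O.tail (scale f) ⊠ scale g) k
      ≈⟨ +-cong (*-congʳ {x * g (suc k)} (≈-trans (*-congʳ {f 0} X^0≈1#) (*-identityˡ (f 0))))
                (O.⊗-cong {g = scale g} (tail-scale f) (λ j → ≈-refl) k) ⟩
    f 0 * (x * g (suc k)) + ((X^ 2 O.· scale (O.tail f)) ⊠ scale g) k
      ≈⟨ +-congˡ {f 0 * (x * g (suc k))} (O.·-⊗ (X^ 2) (scale (O.tail f)) (scale g) k) ⟩
    f 0 * (x * g (suc k)) + X^ 2 * (scale (O.tail f) ⊠ scale g) k
      ≈⟨ +-congˡ {f 0 * (x * g (suc k))} (*-congˡ {X^ 2} (scale-⊠ (O.tail f) g k)) ⟩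
    f 0 * (x * g (suc k)) + X^ 2 * (X^ (2 ℕ.* k) * c)
      ≈⟨ +-congˡ {f 0 * (x * g (suc k))} (≈-sym (*-assoc (X^ 2) (X^ (2 ℕ.* k)) c)) ⟩
    f 0 * (x * g (suc k)) + X^ 2 * X^ (2 ℕ.* k) * c
      ≈⟨ +-congˡ {f 0 * (x * g (suc k))} (*-congʳ {c} (≈-sym (X^-+ 2 (2 ℕ.* k)))) ⟩
    f 0 * (x * g (suc k)) + X^ (2 ℕ.+ 2 ℕ.* k) * c
      ≡⟨ ≡.cong (λ i → f 0 * (x * g (suc k)) + X^ i * c) (≡.sym (ℕ.*-suc 2 k)) ⟩
    f 0 * (x * g (suc k)) + x * c
      ≈⟨ solve 4 (λ f x g c → f :* (x :* g) :+ x :* c := x :* (f :* g :+ c)) ≈-refl (f 0) x (g (suc k)) c ⟩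
    x * (f 0 * g (suc k) + c) ∎
    where
    open ≈-Reasoning
    x = X^ (2 ℕ.* suc k)
    c = (O.tail f ⊠ g) k

  -- The coefficients of z^k in T(z)R(z) and T(z)R′(z). They are the closed forms of y_k and t_k
  -- divided by (p;p)_k, which turns the q-binomials into a plain convolution.
  rrConv rrConv′ : ℕ → FPS
  rrConv = rrTerm ⊠ ratio
  rrConv′ = rrTerm ⊠ ratio′

  rrConv′-suc : ∀ k → rrConv′ (suc k) ≈ rrConv (suc k) + rrConv k
  rrConv′-suc k = begin
    (rrTerm ⊠ ratio′) (suc k)
      ≈⟨ O.⊗-cong {rrTerm} {rrTerm} {ratio′} (λ j → ≈-refl) ratio′≋ (suc k) ⟩
    (rrTerm ⊠ (ratio O.⊕ shift ratio)) (suc k)  ≈⟨ O.⊗-distribˡ rrTerm ratio (shift ratio) (suc k) ⟩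
    (rrTerm ⊠ ratio) (suc k) + (rrTerm ⊠ shift ratio) (suc k)
      ≈⟨ +-congˡ {rrConv (suc k)} (⊠-shiftʳ rrTerm ratio k) ⟩
    rrConv (suc k) + rrConv k  ∎
    where
    open ≈-Reasoning
    ratio′≋ : ratio′ ≋ ratio O.⊕ shift ratio
    ratio′≋ zero    = ≈-sym (≈-trans (+-identityʳ (ratio 0))
      (≈-trans (*-cong oneS≈1# oneS≈1#) (*-identityˡ 1#)))
    ratio′≋ (suc i) = ratio′-suc i

  -- Compares coefficients in F(z) - F(pz) = 2z T(z)R(z) + qz F(pz), where F = T R′.
  rrConv′-scale : ∀ k → 1-X^ (2 ℕ.* suc k) * rrConv′ (suc k) ≈
                           (1# + 1#) * rrConv k + X^ (suc (2 ℕ.* k)) * rrConv′ k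
  rrConv′-scale k = begin
    1-X^ (2 ℕ.* suc k) * rrConv′ (suc k)
      ≈⟨ solve 2 (λ x t → (con (+ 1) :- x) :* t := t :- x :* t) ≈-refl
           (X^ (2 ℕ.* suc k)) (rrConv′ (suc k)) ⟩
    rrConv′ (suc k) - scale rrConv′ (suc k)
      ≈⟨ +-congˡ {rrConv′ (suc k)} (-‿cong (≈-sym (scale-⊠ rrTerm ratio′ (suc k)))) ⟩
    (rrTerm ⊠ ratio′) (suc k) - (scale rrTerm ⊠ scale ratio′) (suc k)
      -- The mixed product T(z)R′(pz) is inserted so that each bracket involves one functional
      -- equation.
      ≈⟨ solve 3 (λ t x s → t :- s := (t :+ :- x) :+ (x :+ :- s)) ≈-refl
           (rrConv′ (suc k)) ((rrTerm ⊠ scale ratio′) (suc k)) ((scale rrTerm ⊠ scale ratio′) (suc k)) ⟩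
    ((rrTerm ⊠ ratio′) (suc k) - (rrTerm ⊠ scale ratio′) (suc k)) +
      ((rrTerm ⊠ scale ratio′) (suc k) - (scale rrTerm ⊠ scale ratio′) (suc k))
      ≈⟨ +-cong (+-congˡ {rrConv′ (suc k)} (-‿distribʳ-* OR.ring rrTerm (scale ratio′) (suc k)))
                (+-congˡ {(rrTerm ⊠ scale ratio′) (suc k)}
                  (-‿distribˡ-* OR.ring (scale rrTerm) (scale ratio′) (suc k))) ⟩
    ((rrTerm ⊠ ratio′) (suc k) + (rrTerm ⊠ (O.⊖ scale ratio′)) (suc k)) +
      ((rrTerm ⊠ scale ratio′) (suc k) + ((O.⊖ scale rrTerm) ⊠ scale ratio′) (suc k))
      ≈⟨ ≈-sym (+-cong (O.⊗-distribˡ rrTerm ratio′ (O.⊖ scale ratio′) (suc k))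
                          (O.⊗-distribʳ (scale ratio′) rrTerm (O.⊖ scale rrTerm) (suc k))) ⟩
    (rrTerm ⊠ (ratio′ O.⊕ O.⊖ scale ratio′)) (suc k) + ((rrTerm O.⊕ O.⊖ scale rrTerm) ⊠ scale ratio′) (suc k)
      ≈⟨ +-cong (O.⊗-cong {rrTerm} {rrTerm} (λ j → ≈-refl) ratio′≋ (suc k))
                (O.⊗-cong {g = scale ratio′} rrTerm≋ (λ j → ≈-refl) (suc k)) ⟩
    (rrTerm ⊠ shift (2# O.· ratio)) (suc k) + (shift (X^ 1 O.· scale rrTerm) ⊠ scale ratio′) (suc k)
      ≈⟨ +-cong (⊠-shiftʳ rrTerm (2# O.· ratio) k) (⊠-shiftˡ (X^ 1 O.· scale rrTerm) (scale ratio′) k) ⟩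
    (rrTerm ⊠ (2# O.· ratio)) k + ((X^ 1 O.· scale rrTerm) ⊠ scale ratio′) k
      ≈⟨ +-cong (⊠-·ʳ 2# rrTerm ratio k) (O.·-⊗ (X^ 1) (scale rrTerm) (scale ratio′) k) ⟩
    2# * rrConv k + X^ 1 * (scale rrTerm ⊠ scale ratio′) k
      ≈⟨ +-congˡ {2# * rrConv k} (*-congˡ {X^ 1} (scale-⊠ rrTerm ratio′ k)) ⟩
    2# * rrConv k + X^ 1 * (X^ (2 ℕ.* k) * rrConv′ k)
      ≈⟨ +-congˡ {2# * rrConv k} (≈-sym (≈-trans (*-congʳ {rrConv′ k} (X^-+ 1 (2 ℕ.* k)))
                                             (*-assoc (X^ 1) (X^ (2 ℕ.* k)) (rrConv′ k)))) ⟩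
    2# * rrConv k + X^ (suc (2 ℕ.* k)) * rrConv′ k ∎
    where
    open ≈-Reasoning
    2# = 1# + 1#
    cancel : ∀ f → f - X^ 0 * f ≈ 0#
    cancel f = ≈-trans (+-congˡ {f} (-‿cong (≈-trans (*-congʳ {f} X^0≈1#) (*-identityˡ f)))) (-‿inverseʳ f)
    ratio′≋ : ratio′ O.⊕ O.⊖ scale ratio′ ≋ shift (2# O.· ratio)
    ratio′≋ zero    = cancel 1#
    ratio′≋ (suc i) = ratio′-scale i
    rrTerm≋ : rrTerm O.⊕ O.⊖ scale rrTerm ≋ shift (X^ 1 O.· scale rrTerm)
    rrTerm≋ zero    = cancel (rrTerm 0)
    rrTerm≋ (suc j) = rrTerm-scale j

  -- The recurrences determine y and t from their initial values; after cancelling Pochhammer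
  -- factors they become `rrConv′-scale` and `rrConv′-suc`. Each step finds `t (suc k)` first, which
  -- then yields `y (suc k)`.
  recurrence-solution : (y t : ℕ → FPS) → y 0 ≈ 1# → t 0 ≈ 1# →
    (∀ k → t (suc k) ≈ (1# + 1#) * y k + X^ (suc (2 ℕ.* k)) * t k) →
    (∀ k → y (suc k) + 1-X^ (2 ℕ.* suc k) * y k ≈ t (suc k)) →
    ∀ k → y k ≈ q²Poch k * rrConv k × t k ≈ q²Poch k * rrConv′ k
  recurrence-solution y t y₀ t₀ t-suc y-suc zero = ≈-trans y₀ (≈-sym base) , ≈-trans t₀ (≈-sym base′)
    where
    rrTerm₀ : rrTerm 0 ≈ 1#
    rrTerm₀ = ≈-trans (*-cong X^0≈1# oneS≈1#) (*-identityˡ 1#)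
    base′ : q²Poch 0 * rrConv′ 0 ≈ 1#
    base′ = ≈-trans (*-cong oneS≈1# (≈-trans (*-congʳ {1#} rrTerm₀) (*-identityˡ 1#))) (*-identityˡ 1#)
    ratio₀ : ratio 0 ≈ 1#
    ratio₀ = ≈-trans (*-cong oneS≈1# oneS≈1#) (*-identityˡ 1#)
    base : q²Poch 0 * rrConv 0 ≈ 1#
    base = ≈-trans (*-cong oneS≈1# (≈-trans (*-cong rrTerm₀ ratio₀) (*-identityˡ 1#))) (*-identityˡ 1#)
  recurrence-solution y t y₀ t₀ t-suc y-suc (suc k) = y≈ , t≈
    where
    open ≈-Reasoning
    ih = recurrence-solution y t y₀ t₀ t-suc y-suc k
    x = 1-X^ (2 ℕ.* suc k)
    q = X^ (suc (2 ℕ.* k))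
    q²Poch-suc : q²Poch (suc k) ≈ q²Poch k * x
    q²Poch-suc = prodTo-suc (λ k → 1-X^ (2 ℕ.* k)) k
    t≈ : t (suc k) ≈ q²Poch (suc k) * rrConv′ (suc k)
    t≈ = begin
      t (suc k)  ≈⟨ t-suc k ⟩
      (1# + 1#) * y k + q * t k
        ≈⟨ +-cong (*-congˡ {1# + 1#} (proj₁ ih)) (*-congˡ {q} (proj₂ ih)) ⟩
      (1# + 1#) * (q²Poch k * rrConv k) + q * (q²Poch k * rrConv′ k)
        ≈⟨ solve 4 (λ p y q t → let 2# = con (+ 1) :+ con (+ 1) in
                      2# :* (p :* y) :+ q :* (p :* t) := p :* (2# :* y :+ q :* t))
             ≈-refl (q²Poch k) (rrConv k) q (rrConv′ k) ⟩
      q²Poch k * ((1# + 1#) * rrConv k + q * rrConv′ k)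
        ≈⟨ *-congˡ {q²Poch k} (≈-sym (rrConv′-scale k)) ⟩
      q²Poch k * (x * rrConv′ (suc k))  ≈⟨ ≈-sym (*-assoc (q²Poch k) x (rrConv′ (suc k))) ⟩
      q²Poch k * x * rrConv′ (suc k)  ≈⟨ *-congʳ {rrConv′ (suc k)} (≈-sym q²Poch-suc) ⟩
      q²Poch (suc k) * rrConv′ (suc k)  ∎
    y≈ : y (suc k) ≈ q²Poch (suc k) * rrConv (suc k)
    y≈ = begin
      y (suc k)
        ≈⟨ solve 2 (λ y z → y := y :+ z :- z) ≈-refl (y (suc k)) (x * y k) ⟩
      y (suc k) + x * y k - x * y k
        ≈⟨ +-cong (≈-trans (y-suc k) t≈) (-‿cong (*-congˡ {x} (proj₁ ih))) ⟩
      q²Poch (suc k) * rrConv′ (suc k) - x * (q²Poch k * rrConv k)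
        ≈⟨ +-congʳ (*-cong q²Poch-suc (rrConv′-suc k)) ⟩
      q²Poch k * x * (rrConv (suc k) + rrConv k) - x * (q²Poch k * rrConv k)
        ≈⟨ solve 4 (λ p x y z → p :* x :* (y :+ z) :- x :* (p :* z) := p :* x :* y) ≈-refl
             (q²Poch k) x (rrConv (suc k)) (rrConv k) ⟩
      q²Poch k * x * rrConv (suc k)  ≈⟨ *-congʳ {rrConv (suc k)} (≈-sym q²Poch-suc) ⟩
      q²Poch (suc k) * rrConv (suc k)  ∎

  -- The generating functions of boxes

  fullSeries boxSeries : ℕ → ℕ → FPS
  fullSeries a b N = + full a b N
  boxSeries a b N = + box a b N

  boxSeries-0 : ∀ a → boxSeries a 0 ≈ 0#
  boxSeries-0 a N = ≡.cong +_ (sumBelow-0 _ a (λ _ _ → ≡.refl))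

  fullSeries≈ : ∀ {a b} → b ≤ 1 ℕ.+ a → a ≤ 3 ℕ.+ b →
                fullSeries a b ≈ X^ (a ℕ.+ b) * boxSeries (suc a) (suc b)
  fullSeries≈ {a} {b} b≤ a≤ N = coefficient (N ℕ.<? a ℕ.+ b)
    where
    coefficient : ∀ {N} → Dec (N < a ℕ.+ b) → fullSeries a b N ≡ (X^ (a ℕ.+ b) * boxSeries (suc a) (suc b)) N
    coefficient (yes N<) = ≡.trans (≡.cong +_ (full-small {a} {b} N<))
                                    (≡.sym (X^*-< (a ℕ.+ b) (boxSeries (suc a) (suc b)) N<))
    coefficient (no N≮) with ℕ.m≤n⇒∃[o]m+o≡n (ℕ.≮⇒≥ N≮)
    ... | M , ≡.refl = ≡.trans (≡.cong +_ (full-shift {a} {b} M b≤ a≤))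
                               (≡.sym (X^*-+ (a ℕ.+ b) (boxSeries (suc a) (suc b)) M))

  boxSeries-rec : ∀ {a b} → b ≤ 1 ℕ.+ a → a ≤ 3 ℕ.+ b →
                  1-X^ (a ℕ.+ b) * boxSeries (suc a) (suc b) ≈
                  boxSeries (suc a) b + boxSeries a (suc b) - boxSeries a b
  boxSeries-rec {a} {b} b≤ a≤ = begin
    1-X^ (a ℕ.+ b) * b₁₁
      ≈⟨ solve 2 (λ x b → (con (+ 1) :- x) :* b := b :- x :* b) ≈-refl (X^ (a ℕ.+ b)) b₁₁ ⟩
    b₁₁ - X^ (a ℕ.+ b) * b₁₁  ≈⟨ +-congˡ {b₁₁} (-‿cong (≈-sym (fullSeries≈ b≤ a≤))) ⟩
    b₁₁ - fullSeries a b
      ≈⟨ solve 5 (λ f e b₀₁ b₀₀ b₁₁ → b₁₁ :- f :=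
                    b₁₁ :- (f :+ e :+ b₀₁) :+ (e :+ b₀₀ :+ b₀₁ :- b₀₀)) ≈-refl
           (fullSeries a b) e (boxSeries a (suc b)) (boxSeries a b) b₁₁ ⟩
    b₁₁ - (fullSeries a b + e + boxSeries a (suc b)) +
      (e + boxSeries a b + boxSeries a (suc b) - boxSeries a b)
      -- By computation of `sumBelow` the subtracted bracket is `b₁₁` itself, and
      -- `e + boxSeries a b` is `boxSeries (suc a) b`.
      ≈⟨ +-congʳ {e + boxSeries a b + boxSeries a (suc b) - boxSeries a b} (-‿inverseʳ b₁₁) ⟩
    0# + (boxSeries (suc a) b + boxSeries a (suc b) - boxSeries a b)
      ≈⟨ +-identityˡ (boxSeries (suc a) b + boxSeries a (suc b) - boxSeries a b) ⟩
    boxSeries (suc a) b + boxSeries a (suc b) - boxSeries a b ∎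
    where
    open ≈-Reasoning
    b₁₁ = boxSeries (suc a) (suc b)
    e : FPS
    e N = + edge a b N

  qPoch-suc : ∀ n → qPoch (suc n) ≈ qPoch n * 1-X^ suc n
  qPoch-suc = prodTo-suc 1-X^_

  qPoch*boxSeries-rec : ∀ {a b n} → a ℕ.+ b ≡ suc n → b ≤ 1 ℕ.+ a → a ≤ 3 ℕ.+ b →
           qPoch (suc n) * boxSeries (suc a) (suc b) ≈
         qPoch n * (boxSeries (suc a) b + boxSeries a (suc b) - boxSeries a b)
  qPoch*boxSeries-rec {a} {b} {n} a+b≡ b≤ a≤ = begin
    qPoch (suc n) * b₁₁  ≈⟨ *-congʳ {b₁₁} (qPoch-suc n) ⟩
    qPoch n * 1-X^ suc n * b₁₁  ≈⟨ *-assoc (qPoch n) (1-X^ suc n) b₁₁ ⟩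
    qPoch n * (1-X^ suc n * b₁₁)  ≡⟨ ≡.cong (λ k → qPoch n * (1-X^ k * b₁₁)) (≡.sym a+b≡) ⟩
    qPoch n * (1-X^ (a ℕ.+ b) * b₁₁)  ≈⟨ *-congˡ {qPoch n} (boxSeries-rec b≤ a≤) ⟩
    qPoch n * (boxSeries (suc a) b + boxSeries a (suc b) - boxSeries a b) ∎
    where
    open ≈-Reasoning
    b₁₁ = boxSeries (suc a) (suc b)

  -- boxSeries (suc a) (suc b), with at most a and b parts, lies on the diagonal a - b.
  D₀ D₂ D₋₁ D₃ D₁ Dₑ : ℕ → FPS
  D₀ k = qPoch (2 ℕ.* k) * boxSeries (1 ℕ.+ k) (1 ℕ.+ k)
  D₂ k = qPoch (2 ℕ.* k) * boxSeries (2 ℕ.+ k) k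
  D₋₁ k = qPoch (suc (2 ℕ.* k)) * boxSeries (1 ℕ.+ k) (2 ℕ.+ k)
  D₁ k = qPoch (suc (2 ℕ.* k)) * boxSeries (2 ℕ.+ k) (1 ℕ.+ k)
  D₃ k = qPoch (suc (2 ℕ.* k)) * boxSeries (3 ℕ.+ k) k
  Dₑ k = D₀ k + D₂ k

  k+1+k≡ : ∀ k → k ℕ.+ suc k ≡ suc (2 ℕ.* k)
  k+1+k≡ k = ≡.trans (ℕ.+-suc k k) (≡.cong (λ i → suc (k ℕ.+ i)) (≡.sym (ℕ.+-identityʳ k)))

  2*suc : ∀ k → 2 ℕ.* suc k ≡ suc (suc (2 ℕ.* k))
  2*suc = ℕ.*-suc 2

  -- The neighbour outside the strip, on diagonal -2, equals B(k-1, k) by `box-widen` and cancels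
  -- the subtracted term, leaving B(k, k).
  D₋₁≈D₀ : ∀ k → D₋₁ k ≈ D₀ k
  D₋₁≈D₀ k = begin
    D₋₁ k  ≈⟨ qPoch*boxSeries-rec {k} {suc k} (k+1+k≡ k) ℕ.≤-refl (ℕ.m≤n+m k 4) ⟩
    qPoch (2 ℕ.* k) * (boxSeries (suc k) (suc k) + boxSeries k (2 ℕ.+ k) - boxSeries k (suc k))
      ≈⟨ *-congˡ {qPoch (2 ℕ.* k)} (+-congʳ { - (boxSeries k (suc k))}
           (+-congˡ {boxSeries (suc k) (suc k)} λ N → ≡.cong +_ (box-widen N (ℕ.n<1+n k)))) ⟩
    qPoch (2 ℕ.* k) * (boxSeries (suc k) (suc k) + boxSeries k (suc k) - boxSeries k (suc k))
      ≈⟨ solve 3 (λ q b c → q :* (b :+ c :- c) := q :* b) ≈-refl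
           (qPoch (2 ℕ.* k)) (boxSeries (suc k) (suc k)) (boxSeries k (suc k)) ⟩
    D₀ k ∎
    where open ≈-Reasoning

  -- The same cancellation with the neighbour on diagonal 4, by `box-heighten`; at `k = 0` both
  -- boxes are empty.
  D₃≈D₂ : ∀ k → D₃ k ≈ D₂ k
  D₃≈D₂ zero    = ≈-trans (*-congˡ {qPoch 1} (boxSeries-0 3)) (≈-trans (zeroʳ (qPoch 1))
                  (≈-sym (≈-trans (*-congˡ {qPoch 0} (boxSeries-0 2)) (zeroʳ (qPoch 0)))))
  D₃≈D₂ (suc j) = begin
    D₃ (suc j)  ≈⟨ qPoch*boxSeries-rec {3 ℕ.+ j} {j} a+b≡ (ℕ.m≤n+m j 4) ℕ.≤-refl ⟩
    q * (boxSeries (4 ℕ.+ j) j + boxSeries (3 ℕ.+ j) (suc j) - boxSeries (3 ℕ.+ j) j)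
      ≈⟨ *-congˡ {q} (+-congʳ { - (boxSeries (3 ℕ.+ j) j)}
           (+-congʳ {boxSeries (3 ℕ.+ j) (suc j)} λ N → ≡.cong +_ (box-heighten {3 ℕ.+ j} {j} N ℕ.≤-refl))) ⟩
    q * (boxSeries (3 ℕ.+ j) j + boxSeries (3 ℕ.+ j) (suc j) - boxSeries (3 ℕ.+ j) j)
      ≈⟨ solve 3 (λ q b c → q :* (c :+ b :- c) := q :* b) ≈-refl
           q (boxSeries (3 ℕ.+ j) (suc j)) (boxSeries (3 ℕ.+ j) j) ⟩
    D₂ (suc j)  ∎
    where
    open ≈-Reasoning
    q = qPoch (2 ℕ.* suc j)
    a+b≡ : 3 ℕ.+ j ℕ.+ j ≡ suc (2 ℕ.* suc j)
    a+b≡ = ≡.cong suc (≡.trans (≡.cong (λ i → suc (suc (j ℕ.+ i))) (≡.sym (ℕ.+-identityʳ j)))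
                               (≡.sym (2*suc j)))

  -- Shared by diagonals 0 and 2: `b₂` lies on the boundary diagonal and is traded for `b₀` by the
  -- second hypothesis, while `b₃` lies on diagonal 1. The power of q is what remains of 1 - (1 -
  -- q^(2k+1)).
  diagonal-suc : ∀ {b₁ b₂ b₃ b₀} k →
    qPoch (suc (suc (2 ℕ.* k))) * b₁ ≈ qPoch (suc (2 ℕ.* k)) * (b₂ + b₃ - b₀) →
    qPoch (suc (2 ℕ.* k)) * b₂ ≈ qPoch (2 ℕ.* k) * b₀ →
    qPoch (2 ℕ.* suc k) * b₁ ≈ qPoch (suc (2 ℕ.* k)) * b₃ + X^ suc (2 ℕ.* k) * (qPoch (2 ℕ.* k) * b₀)
  diagonal-suc {b₁} {b₂} {b₃} {b₀} k rec edge≈ = begin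
    qPoch (2 ℕ.* suc k) * b₁  ≡⟨ ≡.cong (λ i → qPoch i * b₁) (2*suc k) ⟩
    qPoch (suc (suc (2 ℕ.* k))) * b₁  ≈⟨ rec ⟩
    q′ * (b₂ + b₃ - b₀)
      ≈⟨ solve 4 (λ q b₂ b₃ b₀ → q :* (b₂ :+ b₃ :- b₀) := q :* b₃ :+ (q :* b₂ :- q :* b₀)) ≈-refl
           q′ b₂ b₃ b₀ ⟩
    q′ * b₃ + (q′ * b₂ - q′ * b₀)
      ≈⟨ +-congˡ {q′ * b₃} (+-cong edge≈ (-‿cong (*-congʳ {b₀} (qPoch-suc (2 ℕ.* k))))) ⟩
    q′ * b₃ + (q * b₀ - q * 1-X^ suc (2 ℕ.* k) * b₀)
      ≈⟨ +-congˡ {q′ * b₃}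
           (solve 3 (λ q x b → q :* b :- q :* (con (+ 1) :- x) :* b := x :* (q :* b)) ≈-refl
                q (X^ suc (2 ℕ.* k)) b₀) ⟩
    q′ * b₃ + X^ suc (2 ℕ.* k) * (q * b₀) ∎
    where
    open ≈-Reasoning
    q  = qPoch (2 ℕ.* k)
    q′ = qPoch (suc (2 ℕ.* k))

  D₀-suc : ∀ k → D₀ (suc k) ≈ D₁ k + X^ suc (2 ℕ.* k) * D₀ k
  D₀-suc k = diagonal-suc {b₂ = boxSeries (1 ℕ.+ k) (2 ℕ.+ k)} {b₃ = boxSeries (2 ℕ.+ k) (1 ℕ.+ k)} k (begin
    qPoch (suc (suc (2 ℕ.* k))) * boxSeries (2 ℕ.+ k) (2 ℕ.+ k)
      ≈⟨ qPoch*boxSeries-rec {suc k} {suc k} (≡.cong suc (k+1+k≡ k)) (ℕ.n≤1+n _) (ℕ.m≤n+m _ 3) ⟩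
    q′ * (boxSeries (2 ℕ.+ k) (1 ℕ.+ k) + boxSeries (1 ℕ.+ k) (2 ℕ.+ k) - boxSeries (1 ℕ.+ k) (1 ℕ.+ k))
      ≈⟨ *-congˡ {q′} (+-congʳ { - (boxSeries (1 ℕ.+ k) (1 ℕ.+ k))}
           (+-comm (boxSeries (2 ℕ.+ k) (1 ℕ.+ k)) (boxSeries (1 ℕ.+ k) (2 ℕ.+ k)))) ⟩
    q′ * (boxSeries (1 ℕ.+ k) (2 ℕ.+ k) + boxSeries (2 ℕ.+ k) (1 ℕ.+ k) - boxSeries (1 ℕ.+ k) (1 ℕ.+ k)) ∎)
    (D₋₁≈D₀ k)
    where
    open ≈-Reasoning
    q′ = qPoch (suc (2 ℕ.* k))

  D₂-suc : ∀ k → D₂ (suc k) ≈ D₁ k + X^ suc (2 ℕ.* k) * D₂ k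
  D₂-suc k = diagonal-suc {b₂ = boxSeries (3 ℕ.+ k) k} {b₃ = boxSeries (2 ℕ.+ k) (1 ℕ.+ k)} k
    (qPoch*boxSeries-rec {2 ℕ.+ k} {k} (≡.cong (λ i → suc (suc (k ℕ.+ i))) (≡.sym (ℕ.+-identityʳ k)))
      (ℕ.m≤n+m k 3) (ℕ.n≤1+n _))
    (D₃≈D₂ k)

  Dₑ-suc : ∀ k → Dₑ (suc k) ≈ (1# + 1#) * D₁ k + X^ suc (2 ℕ.* k) * Dₑ k
  Dₑ-suc k = ≈-trans (+-cong (D₀-suc k) (D₂-suc k))
    (solve 4 (λ y x u v → (y :+ x :* u) :+ (y :+ x :* v) := (con (+ 1) :+ con (+ 1)) :* y :+ x :* (u :+ v))
      ≈-refl (D₁ k) (X^ suc (2 ℕ.* k)) (D₀ k) (D₂ k))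

  -- The subtracted term is left as a box, which is empty at `k = 0`; for later `k`, `D₁-suc`
  -- rewrites it as 1 - q^(2k) times `D₁ (k - 1)`.
  D₁≈Dₑ- : ∀ k → D₁ k ≈ Dₑ k - qPoch (2 ℕ.* k) * boxSeries (1 ℕ.+ k) k
  D₁≈Dₑ- k = ≈-trans
    (qPoch*boxSeries-rec {suc k} {k} (≡.cong (λ i → suc (k ℕ.+ i)) (≡.sym (ℕ.+-identityʳ k)))
      (ℕ.m≤n+m k 2) (ℕ.+-monoˡ-≤ k (s≤s z≤n)))
    (solve 4 (λ q v u b → q :* (v :+ u :- b) := q :* u :+ q :* v :- q :* b) ≈-refl
      (qPoch (2 ℕ.* k)) (boxSeries (2 ℕ.+ k) k) (boxSeries (1 ℕ.+ k) (1 ℕ.+ k)) (boxSeries (1 ℕ.+ k) k))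

  D₁-suc : ∀ k → D₁ (suc k) + 1-X^ (2 ℕ.* suc k) * D₁ k ≈ Dₑ (suc k)
  D₁-suc k = begin
    D₁ (suc k) + x * D₁ k  ≈⟨ +-congʳ {x * D₁ k} (D₁≈Dₑ- (suc k)) ⟩
    Dₑ (suc k) - qPoch (2 ℕ.* suc k) * b + x * D₁ k
      ≈⟨ +-congʳ {x * D₁ k} (+-congˡ {Dₑ (suc k)} (-‿cong Qb)) ⟩
    Dₑ (suc k) - x * D₁ k + x * D₁ k
      ≈⟨ solve 2 (λ t z → t :- z :+ z := t) ≈-refl (Dₑ (suc k)) (x * D₁ k) ⟩
    Dₑ (suc k)  ∎
    where
    open ≈-Reasoning
    x = 1-X^ (2 ℕ.* suc k)
    b = boxSeries (2 ℕ.+ k) (1 ℕ.+ k)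
    Qb : qPoch (2 ℕ.* suc k) * b ≈ x * D₁ k
    Qb = begin
      -- `b` is the box of `D₁ k` as well; the Pochhammer index is one higher, which contributes the
      -- factor `x`.
      qPoch (2 ℕ.* suc k) * b  ≈⟨ *-congʳ {b} (qPoch-suc (k ℕ.+ (suc k ℕ.+ 0))) ⟩
      qPoch (k ℕ.+ (suc k ℕ.+ 0)) * x * b
        ≡⟨ ≡.cong (λ i → qPoch i * x * b) (ℕ.suc-injective (2*suc k)) ⟩
      qPoch (suc (2 ℕ.* k)) * x * b
        ≈⟨ solve 3 (λ q x b → q :* x :* b := x :* (q :* b)) ≈-refl (qPoch (suc (2 ℕ.* k))) x b ⟩
      x * D₁ k  ∎

  Dₑ-0 : Dₑ 0 ≈ 1#
  Dₑ-0 = begin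
    qPoch 0 * boxSeries 1 1 + qPoch 0 * boxSeries 2 0
      ≈⟨ +-cong (≈-trans (*-cong oneS≈1# B₁₁) (*-identityˡ 1#))
                (≈-trans (*-congˡ {qPoch 0} (boxSeries-0 2)) (zeroʳ (qPoch 0))) ⟩
    1# + 0#  ≈⟨ +-identityʳ 1# ⟩
    1#  ∎
    where
    open ≈-Reasoning
    B₁₁ : boxSeries 1 1 ≈ 1#
    B₁₁ zero    = ≡.cong (λ c → + (c ℕ.+ 0 ℕ.+ 0)) full-0-0-0
    B₁₁ (suc N) = ≡.cong (λ c → + (c ℕ.+ 0 ℕ.+ 0)) (full-0-0-suc N)

  D₁-0 : D₁ 0 ≈ 1#
  D₁-0 = begin
    D₁ 0  ≈⟨ D₁≈Dₑ- 0 ⟩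
    Dₑ 0 - qPoch 0 * boxSeries 1 0
      ≈⟨ +-cong Dₑ-0 (-‿cong (≈-trans (*-congˡ {qPoch 0} (boxSeries-0 1)) (zeroʳ (qPoch 0)))) ⟩
    1# - 0#  ≈⟨ (λ N → ℤ.+-identityʳ (1# N)) ⟩
    1#  ∎
    where open ≈-Reasoning

  D₁≈q²Poch*rrConv : ∀ k → D₁ k ≈ q²Poch k * rrConv k
  D₁≈q²Poch*rrConv k = proj₁ (recurrence-solution D₁ Dₑ D₁-0 Dₑ-0 Dₑ-suc D₁-suc k)

  -- Truncation modulo q^(N+1)

  infix 4 _≈[_]_
  _≈[_]_ : FPS → ℕ → FPS → Set
  f ≈[ N ] g = ∀ {n} → n ≤ N → f n ≡ g n

  *-cong-≈[] : ∀ {N f f′ g g′} → f ≈[ N ] f′ → g ≈[ N ] g′ → f * g ≈[ N ] f′ * g′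
  *-cong-≈[] p q {n} n≤N = ⊗-cong-≤ n (λ i≤n → p (ℕ.≤-trans i≤n n≤N)) (λ i≤n → q (ℕ.≤-trans i≤n n≤N))

  X^-≈[] : ∀ {N k} → N < k → X^ k ≈[ N ] 0#
  X^-≈[] {N} {k} N<k {n} n≤N =
    ≡.cong (if_then (+ 1) else (+ 0)) (dec-false (n ℕ.≟ k) (ℕ.<⇒≢ (ℕ.≤-<-trans n≤N N<k)))

  onePlusQ-≈[] : ∀ {N k} → N < k → onePlusQ k ≈[ N ] 1#
  onePlusQ-≈[] N<k {n} n≤N = ≡.trans (≡.cong₂ ℤ._+_ (oneS≈1# n) (X^-≈[] N<k n≤N)) (ℤ.+-identityʳ _)

  1-X^-≈[] : ∀ {N k} → N < k → 1-X^ k ≈[ N ] 1#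
  1-X^-≈[] N<k {n} n≤N = ≡.trans (≡.cong (λ c → 1# n ℤ.- c) (X^-≈[] N<k n≤N)) (ℤ.+-identityʳ _)

  geomInv-≈[] : ∀ {N k} → N < k → geomInv k ≈[ N ] 1#
  geomInv-≈[] N<k {n} n≤N = ≡.trans (geomInv-< (ℕ.≤-<-trans n≤N N<k)) (oneS≈1# n)

  n<2*suc : ∀ n → n < 2 ℕ.* suc n
  n<2*suc n = ℕ.m≤m+n (suc n) (suc n ℕ.+ 0)

  -- Factors with index above `n` are 1 modulo q^(n+1), so coefficient `n` no longer changes after
  -- the product up to `n`, where `prodInf` reads it off.
  prodTo-stable : ∀ {F} → (∀ k → F (suc k) ≈[ k ] 1#) → ∀ {m n} → n ≤ m → prodTo F m n ≡ prodInf F n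
  prodTo-stable h {zero}  z≤n = ≡.refl
  prodTo-stable {F} h {suc m} {n} n≤1+m with ℕ.m≤n⇒m<n∨m≡n n≤1+m
  ... | inj₂ ≡.refl = ≡.refl
  ... | inj₁ (s≤s n≤m) = ≡.trans (prodTo-suc F m n)
    (≡.trans (*-cong-≈[] {m} {prodTo F m} (λ _ → ≡.refl) (h m) n≤m)
      (≡.trans (*-identityʳ (prodTo F m) n) (prodTo-stable h n≤m)))

  negQ²Poch-stable : ∀ {N i} → N ≤ i → negQ²Poch i ≈[ N ] negQ2PochInf
  negQ²Poch-stable N≤i n≤N = prodTo-stable (λ k → onePlusQ-≈[] (n<2*suc k)) (ℕ.≤-trans n≤N N≤i)

  q²Poch-stable : ∀ {N i j} → N ≤ i → N ≤ j → q²Poch i ≈[ N ] q²Poch j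
  q²Poch-stable N≤i N≤j {n} n≤N = ≡.trans (stable N≤i) (≡.sym (stable N≤j))
    where
    stable : ∀ {i} → _ ≤ i → q²Poch i n ≡ prodInf (λ k → 1-X^ (2 ℕ.* k)) n
    stable N≤i = prodTo-stable (λ k → 1-X^-≈[] (n<2*suc k)) (ℕ.≤-trans n≤N N≤i)

  invQPoch-stable : ∀ {N i} → N ≤ i → prodTo geomInv i ≈[ N ] invQPochInf
  invQPoch-stable N≤i n≤N = prodTo-stable (λ k → geomInv-≈[] (ℕ.n<1+n k)) (ℕ.≤-trans n≤N N≤i)

  q²Poch*ratio : ∀ i → q²Poch i * ratio i ≈ negQ²Poch i
  q²Poch*ratio i = begin
    q²Poch i * (negQ²Poch i * I)
      ≈⟨ solve 3 (λ p μ i → p :* (μ :* i) := p :* i :* μ) ≈-refl (q²Poch i) (negQ²Poch i) I ⟩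
    q²Poch i * I * negQ²Poch i  ≈⟨ *-congʳ {negQ²Poch i} (q²Poch-inverse i) ⟩
    1# * negQ²Poch i  ≈⟨ *-identityˡ (negQ²Poch i) ⟩
    negQ²Poch i  ∎
    where
    open ≈-Reasoning
    I = invQ2Poch i

  -- Modulo q^(N+1) the prefactor may change its index from `k` to `i`, where it cancels the
  -- denominator of `ratio i`.
  q²Poch*ratio-stable : ∀ {N i k} → N ≤ i → N ≤ k → q²Poch k * ratio i ≈[ N ] negQ2PochInf
  q²Poch*ratio-stable {N} {i} {k} N≤i N≤k {n} n≤N = ≡.trans
    (*-cong-≈[] {N} {q²Poch k} {q²Poch i} {ratio i} (q²Poch-stable N≤k N≤i) (λ _ → ≡.refl) n≤N)
    (≡.trans (q²Poch*ratio i n) (negQ²Poch-stable N≤i n≤N))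

  rrTerm-small : ∀ {N j} → N < j → rrTerm j ≈[ N ] 0#
  rrTerm-small {N} {j@(suc _)} N<j {n} n≤N =
    X^*-< (j ℕ.* j) (invQ2Poch j) (ℕ.<-≤-trans (ℕ.≤-<-trans n≤N N<j) (ℕ.m≤m*n j j))

  -- The hypothesis keeps the weight `b j`: for large `j` the two sequences may differ at `i`, and
  -- agreement comes from the vanishing of `b j`.
  ⊠-cong-≈[] : ∀ {N} b f g k → (∀ i j → i ℕ.+ j ≡ k → b j * f i ≈[ N ] b j * g i) → (b ⊠ f) k ≈[ N ] (b ⊠ g) k
  ⊠-cong-≈[] b f g zero    h n≤N = h 0 0 ≡.refl n≤N
  ⊠-cong-≈[] b f g (suc k) h n≤N = ≡.cong₂ ℤ._+_ (h (suc k) 0 (ℕ.+-identityʳ (suc k)) n≤N)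
    (⊠-cong-≈[] (O.tail b) f g k (λ i j i+j≡k → h i (suc j) (≡.trans (ℕ.+-suc i j) (≡.cong suc i+j≡k))) n≤N)

  ⊠-constant : ∀ b c k → (b ⊠ (λ _ → c)) k ≈ (λ n → sumTo (λ j → b j n) k) * c
  ⊠-constant b c zero    = ≈-refl
  ⊠-constant b c (suc k) = begin
    b 0 * c + (O.tail b ⊠ (λ _ → c)) k
      ≈⟨ +-congˡ {b 0 * c} (⊠-constant (O.tail b) c k) ⟩
    b 0 * c + (λ n → sumTo (λ j → b (suc j) n) k) * c
      ≈⟨ ≈-sym (distribʳ c (b 0) (λ n → sumTo (λ j → b (suc j) n) k)) ⟩
    (b 0 + (λ n → sumTo (λ j → b (suc j) n) k)) * c
      ≈⟨ *-congʳ {c} (λ n → ≡.sym (sumTo-suc (λ j → b j n) k)) ⟩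
    (λ n → sumTo (λ j → b j n) (suc k)) * c ∎
    where open ≈-Reasoning

  sumTo-cong : ∀ {f g} → (∀ i → f i ≡ g i) → ∀ n → sumTo f n ≡ sumTo g n
  sumTo-cong h zero    = h 0
  sumTo-cong h (suc n) = ≡.cong₂ ℤ._+_ (sumTo-cong h n) (h (suc n))

  sumTo-stable : ∀ {f n} → (∀ i → n < i → f i ≡ + 0) → ∀ {k} → n ≤ k → sumTo f k ≡ sumTo f n
  sumTo-stable h {zero} z≤n = ≡.refl
  sumTo-stable h {suc k} n≤1+k with ℕ.m≤n⇒m<n∨m≡n n≤1+k
  ... | inj₂ ≡.refl = ≡.refl
  ... | inj₁ n<1+k@(s≤s n≤k) =
    ≡.trans (≡.cong₂ ℤ._+_ (sumTo-stable h n≤k) (h (suc k) n<1+k)) (ℤ.+-identityʳ _)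

  sum-rrTerm : ∀ {N k} → N ≤ k → (λ n → sumTo (λ j → rrTerm j n) k) ≈[ N ] rogersRamanujanSum
  sum-rrTerm N≤k {n} n≤N = ≡.trans
    (sumTo-stable (λ j n<j → rrTerm-small {n} {j} n<j ℕ.≤-refl) (ℕ.≤-trans n≤N N≤k))
    (sumTo-cong (λ j → ≡.sym (⊛≈* (X^ (j ℕ.* j)) (invQ2Poch j) n)) n)

  -- In a split i + j = 2N either j ≤ N, so that i ≥ N and the factor at `i` has reached its limit,
  -- or j > N and `rrTerm j` vanishes modulo q^(N+1). What is left is a partial sum times the limit.
  q²Poch*rrConv-stable : ∀ N → q²Poch (N ℕ.+ N) * rrConv (N ℕ.+ N) ≈[ N ] rogersRamanujanSum * negQ2PochInf
  q²Poch*rrConv-stable N {n} n≤N = begin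
    (q²Poch K * rrConv K) n  ≡⟨ ≡.sym (⊠-·ʳ (q²Poch K) rrTerm ratio K n) ⟩
    (rrTerm ⊠ (q²Poch K O.· ratio)) K n
      ≡⟨ ⊠-cong-≈[] rrTerm (q²Poch K O.· ratio) (λ _ → c) K terms n≤N ⟩
    (rrTerm ⊠ (λ _ → c)) K n  ≡⟨ ⊠-constant rrTerm c K n ⟩
    ((λ n → sumTo (λ j → rrTerm j n) K) * c) n
      ≡⟨ *-cong-≈[] {N} {g = c} (sum-rrTerm (ℕ.m≤m+n N N)) (λ _ → ≡.refl) n≤N ⟩
    (rogersRamanujanSum * c) n  ∎
    where
    open ≡.≡-Reasoning
    K = N ℕ.+ N
    c = negQ2PochInf
    terms : ∀ i j → i ℕ.+ j ≡ K → rrTerm j * (q²Poch K * ratio i) ≈[ N ] rrTerm j * c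
    terms i j i+j≡K with j ℕ.≤? N
    ... | yes j≤N =
      *-cong-≈[] {N} {rrTerm j} (λ _ → ≡.refl) (q²Poch*ratio-stable {N} {i} {K} N≤i (ℕ.m≤m+n N N))
      where
      N≤i : N ≤ i
      N≤i = ℕ.+-cancelʳ-≤ N N i (≡.subst (_≤ i ℕ.+ N) i+j≡K (ℕ.+-monoʳ-≤ i j≤N))
    ... | no j≰N = λ n≤N → ≡.trans (vanish (q²Poch K * ratio i) n≤N) (≡.sym (vanish c n≤N))
      where
      vanish : ∀ f → rrTerm j * f ≈[ N ] 0#
      vanish f {n} n≤N =
        ≡.trans (*-cong-≈[] {N} {rrTerm j} {0#} {f} (rrTerm-small {N} {j} (ℕ.≰⇒> j≰N)) (λ _ → ≡.refl) n≤N)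
                (zeroˡ f n)

  rhs53≈ : rhs53 ≈ rogersRamanujanSum * negQ2PochInf * invQPochInf
  rhs53≈ = ≈-trans (⊛≈* (rogersRamanujanSum ⊛ negQ2PochInf) invQPochInf)
                   (*-congʳ {invQPochInf} (⊛≈* rogersRamanujanSum negQ2PochInf))

  box-rhs53 : ∀ N → + box (2 ℕ.+ (N ℕ.+ N)) (1 ℕ.+ (N ℕ.+ N)) N ≡ rhs53 N
  box-rhs53 N = begin
    b N  ≡⟨ ≡.sym (*-identityˡ b N) ⟩
    -- Inserting (q;q)_(2K+1) and its inverse exposes `D₁ K`, whose closed form is known.
    (1# * b) N  ≡⟨ *-congʳ {b} (≈-sym (qPoch-inverse i)) N ⟩
    (qPoch i * g * b) N  ≡⟨ solve 3 (λ q g b → q :* g :* b := q :* b :* g) ≈-refl (qPoch i) g b N ⟩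
    (D₁ K * g) N  ≡⟨ *-congʳ {g} (D₁≈q²Poch*rrConv K) N ⟩
    (q²Poch K * rrConv K * g) N
      ≡⟨ *-cong-≈[] {N} {q²Poch K * rrConv K} (q²Poch*rrConv-stable N) (invQPoch-stable N≤i) ℕ.≤-refl ⟩
    (rogersRamanujanSum * negQ2PochInf * invQPochInf) N  ≡⟨ ≡.sym (rhs53≈ N) ⟩
    rhs53 N  ∎
    where
    open ≡.≡-Reasoning
    K = N ℕ.+ N
    i = suc (2 ℕ.* K)
    b = boxSeries (2 ℕ.+ K) (1 ℕ.+ K)
    g = prodTo geomInv i
    N≤i : N ≤ i
    N≤i = ℕ.m≤n⇒m≤1+n (ℕ.≤-trans (ℕ.m≤m+n N N) (ℕ.m≤m+n K (K ℕ.+ 0)))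

theorem5p3 : (N : ℕ) →
    ∃[ m ] ((+ m ≡ rhs53 N) × (CylPartOfSize profile31 N ↔ Fin m))
theorem5p3 N = _ , box-rhs53 N , enumeration⇒↔ (record
  { list = list e ; length≡ = length≡ e ; unique = unique e
  ; sound = λ x∈ → proj₁ (sound e x∈) ; complete = λ c → complete e (Cylindric⇒Box c) })
  where
  open Enumeration
  e = box-enumeration (2 ℕ.+ (N ℕ.+ N)) (1 ℕ.+ (N ℕ.+ N)) N
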